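{- There exists a $5$-uniform hypergraph $\mathcal{H}$ such that the strong game $\mathcal{R}^{(5)}(\mathcal{H}, \aleph_0)$ is a draw.
   Context: For an integer $k\ge 2$ and a finite $k$-uniform hypergraph $\mathcal{H}$, the strong Ramsey game $\mathcal{R}^{(k)}(\mathcal{H}, \aleph_0)$ is played by two players, FP (the first player) and SP (the second player), who alternately claim previously unclaimed edges of the countably infinite complete $k$-uniform hypergraph $K^k_{\mathbb{N}}$ (vertex set $\mathbb{N}$, edges all $k$-subsets), one edge per move, FP moving first. The first player whose claimed edges contain a copy of $\mathcal{H}$ (a subhypergraph isomorphic to $\mathcal{H}$) wins. If neither player has a strategy which ensures his win in finitely many moves, the game is declared a draw. -}

module Defs where

open import Data.Fin.Base using (Fin)
import Data.Fin.Subset as Subset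
open import Data.Fin.Subset using (Subset; ∣_∣)
open import Data.List.Base using (List; []; _∷_)
open import Data.List.Membership.Propositional using (_∉_)
open import Data.List.Relation.Unary.All using (All)
open import Data.List.Relation.Unary.Any using (Any)
open import Data.Nat.Base using (ℕ; zero; suc; _<_)
open import Data.Product.Base using (Σ; ∃; _×_; proj₁)
open import Data.Vec.Base using (Vec)
import Data.Vec.Membership.Propositional as Vec
open import Data.Vec.Relation.Unary.Linked using (Linked)
open import Function.Bundles using (_⇔_)
open import Function.Definitions using (Injective)
open import Relation.Binary.PropositionalEquality.Core using (_≡_)
open import Relation.Nullary.Negation.Core using (¬_)

-- The edge set is given by enumeration; the order of the list and repetitions
-- in it play no role below.
record Hypergraph (k : ℕ) : Set where
  field
    order   : ℕ
    edges   : List (Subset order)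
    uniform : All (λ e → ∣ e ∣ ≡ k) edges

-- A k-subset of ℕ, represented by its increasing enumeration.  Irrelevance of
-- the second field makes _≡_ on edges coincide with equality of subsets.
record Edge (k : ℕ) : Set where
  constructor edge
  field
    vertices    : Vec ℕ k
    .increasing : Linked _<_ vertices

open Edge public

IsImage : ∀ {n k} → (Fin n → ℕ) → Subset n → Edge k → Set
IsImage f e x = ∀ v → v Vec.∈ vertices x ⇔ (∃ λ i → i Subset.∈ e × f i ≡ v)

-- Copies are not required to be induced.
ContainsCopy : ∀ {k} → Hypergraph k → List (Edge k) → Set
ContainsCopy H X = Σ (Fin order → ℕ) λ f →
  Injective _≡_ _≡_ f × All (λ e → Any (IsImage f e) X) edges
  where open Hypergraph H

data Player : Set where
  FP SP : Player

opponent : Player → Player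
opponent FP = SP
opponent SP = FP

-- The moves made so far by both players, most recent first.
History : ℕ → Set
History k = List (Edge k)

toMove : ∀ {k} → History k → Player
toMove []      = FP
toMove (_ ∷ h) = opponent (toMove h)

claimed : ∀ {k} → Player → History k → List (Edge k)
claimed p  []      = []
claimed p  (x ∷ h) with toMove h | p
... | FP | FP = x ∷ claimed p h
... | SP | SP = x ∷ claimed p h
... | FP | SP = claimed p h
... | SP | FP = claimed p h

-- The board is infinite, so an unclaimed edge always exists and a strategy can
-- be asked for a legal move after every history.
Strategy : ℕ → Set
Strategy k = (h : History k) → Σ (Edge k) (_∉ h)

-- The first n moves when each player p follows s p.  Play is formally continued
-- after a win; by the definition of Wins this does not affect the result.
play : ∀ {k} → (Player → Strategy k) → ℕ → History k
play s zero    = []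
play s (suc n) = proj₁ (s (toMove h) h) ∷ h
  where h = play s n

-- Player p owns a copy after some number n of moves, and the opponent owned
-- none at any earlier time.  As only one player moves at a time, the two players
-- cannot both obtain their first copy with the same move, so m < n and m ≤ n
-- determine the same winner; the choice only matters for edgeless H, where
-- m ≤ n would leave no winner and make the game a draw vacuously.
Wins : ∀ {k} → Hypergraph k → Player → (Player → Strategy k) → Set
Wins H p s = ∃ λ n →
  ContainsCopy H (claimed p (play s n)) ×
  (∀ m → m < n → ¬ ContainsCopy H (claimed (opponent p) (play s m)))

versus : ∀ {k} → Player → Strategy k → Strategy k → Player → Strategy k
versus FP σ τ FP = σ
versus FP σ τ SP = τ
versus SP σ τ SP = σ
versus SP σ τ FP = τ

IsWinningStrategy : ∀ {k} → Hypergraph k → Player → Strategy k → Set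
IsWinningStrategy H p σ = ∀ τ → Wins H p (versus p σ τ)

IsDraw : ∀ {k} → Hypergraph k → Set
IsDraw H = ∀ p → ¬ ∃ (IsWinningStrategy H p)

{-# OPTIONS --safe #-}
module Submission where

open import Data.Bool.Base using (Bool; true; T; not; _∧_; _∨_)
open import Data.Bool.ListAction using (all)
open import Data.Bool.Properties using (T?; T-∧; T-∨)
open import Data.Empty using (⊥; ⊥-elim)
open import Data.Fin.Base as F using (Fin; zero; suc; toℕ)
open import Data.Fin.Patterns
open import Data.Fin.Properties as F using (all?; any?)
open import Data.Fin.Subset as Subset using (Subset; ∣_∣)
open import Data.List.Base as L using (List; []; _∷_; length; filter; concatMap; allFin)
import Data.List.Membership.DecPropositional as DecMembership
open import Data.List.Membership.Propositional using (_∈_; _∉_; find; lose)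
open import Data.List.Membership.Propositional.Properties
  using (∈-filter⁺; ∈-filter⁻; ∈-map⁺; ∈-map⁻; ∈-++⁺ˡ; ∈-++⁺ʳ; ∈-++⁻; ∈-concatMap⁺; ∈-tabulate⁺; ∈-allFin)
import Data.List.Properties as L
open import Data.List.Relation.Unary.All as All using (All; []; _∷_)
import Data.List.Relation.Unary.All.Properties as All
open import Data.List.Relation.Unary.AllPairs as AP using ([]; _∷_)
open import Data.List.Relation.Unary.Any as Any using (Any; here; there)
open import Data.List.Relation.Unary.Unique.DecPropositional (F._≟_ {11}) using (unique?)
open import Data.List.Relation.Unary.Unique.Propositional using (Unique)
import Data.List.Relation.Unary.Unique.Propositional.Properties as Unique
open import Data.Nat.Base using (ℕ; zero; suc; _+_; _≤_; _<_; z≤n; s≤s; _≡ᵇ_)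
open import Data.Nat.ListAction using (sum)
open import Data.Nat.Properties as ℕ using (≤-trans; <-trans; <-irrefl)
open import Data.Product.Base using (Σ; ∃; _×_; _,_; proj₁; proj₂)
open import Data.Sum.Base using (_⊎_; inj₁; inj₂; [_,_]′)
open import Data.Unit.Base using (tt)
open import Data.Vec.Base as V using (Vec; []; _∷_; lookup; toList)
import Data.Vec.Membership.Propositional as Vec
import Data.Vec.Membership.Propositional.Properties as V∈
import Data.Vec.Properties as V
import Data.Vec.Relation.Unary.All as VAll
import Data.Vec.Relation.Unary.AllPairs as VAP
import Data.Vec.Relation.Unary.Any as VAny
open import Data.Vec.Relation.Unary.Linked as Linked using (Linked; []; [-]; _∷_)
open import Data.Vec.Relation.Unary.Linked.Properties using (Linked⇒All)
import Data.Vec.Relation.Unary.Unique.Propositional as VU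
import Data.Vec.Relation.Unary.Unique.Propositional.Properties as VU
open import Function.Base using (_∘_; id)
open import Function.Bundles using (mk⇔; Equivalence)
open import Relation.Binary.Definitions using (DecidableEquality)
open import Relation.Binary.PropositionalEquality
  using (_≡_; _≢_; refl; sym; trans; cong; subst; subst₂)
open import Relation.Nullary.Decidable
  using (Dec; yes; no; does; map′; recompute; ¬?; _×-dec_; _⊎-dec_; _→-dec_; dec-true; decidable-stable; from-yes)
open import Relation.Nullary.Negation using (¬_; contradiction)
open import Defs

-- Let the core of H be H without the two edges ("spokes") at its vertex z of degree 2.  A player
-- who owns a core can claim one spoke with ever new vertices in the role of z; the opponent
-- must each time answer with the other spoke, so this goes on forever unless some answer
-- is itself a threat.  Here each of the first six edges of the core contains a vertex in
-- none of the earlier ones, and each of the last two can be claimed in two ways, exchanged by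
-- swapping a pair of twins.  Hence the defender completes a core without wasting a move, when
-- the attacker has at most one edge more.  From then on the defender blocks whenever the
-- attacker threatens, and otherwise starts the endless sequence.  Since H minus two edges
-- embeds in H in only one way and all vertices but z have degree at least 4, the attacker's
-- threats can only follow the same endless pattern on one core.  The defender's sequence
-- gives the attacker a threat only if the answering spoke, without z, is a spoke of a core
-- of the attacker; by counting common vertices this cannot happen for both choices of spoke.

-- Pigeonhole for duplicate-free lists

-- A winning strategy must succeed against every opponent, so it is enough to produce, for a fixed
-- strategy `σ` of the attacker `p`, one play in which the attacker never owns the first copy. The
-- invariant does not record who moved first: its bounds on `length A` leave room for the extra edge
-- that moving first brings. The timing is tight. A core has eight edges and a threat needs nine, so
-- the first threat can arise no earlier than on the attacker's first move after the defender's core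
-- is complete, and it then uses every edge that the attacker owns. The obstacle is the endless
-- sequence, in which the attacker gains arbitrarily many edges: those from before it are frozen as
-- `A₀`, and each later one contains a vertex in no edge of `A₀`. The defender must also decide
-- whether open threats and harmful copies exist; this is a finite search, because apart from z such
-- copies live on the vertices of the attacker's edges.

remove : ∀ {A : Set} {x : A} {ys} → x ∈ ys → List A
remove {ys = _ ∷ ys} (here _)  = ys
remove {ys = y ∷ _}  (there p) = y ∷ remove p

length-remove : ∀ {A : Set} {x : A} {ys} (p : x ∈ ys) → suc (length (remove p)) ≡ length ys
length-remove (here _)          = refl
length-remove (there (here _))  = refl
length-remove (there p@(there _)) = cong suc (length-remove p)

∈-remove : ∀ {A : Set} {x z : A} {ys} (p : x ∈ ys) → z ∈ ys → z ≢ x → z ∈ remove p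
∈-remove (here refl) (here refl) z≢x = contradiction refl z≢x
∈-remove (here _)    (there q)   _   = q
∈-remove (there p)   (here refl) _   = here refl
∈-remove (there p)   (there q)   z≢x = there (∈-remove p q z≢x)

unique-⊆-length : ∀ {A : Set} {xs ys : List A} → Unique xs →
                  (∀ {z} → z ∈ xs → z ∈ ys) → length xs ≤ length ys
unique-⊆-length []        _  = z≤n
unique-⊆-length {xs = x ∷ xs} (x∉ ∷ u) xs⊆ys =
  subst (suc (length xs) ≤_) (length-remove p)
    (s≤s (unique-⊆-length u λ z∈ → ∈-remove p (xs⊆ys (there z∈)) (All.lookup x∉ z∈ ∘ sym)))
  where p = xs⊆ys (here refl)

∉⇒All≢ : ∀ {A : Set} {x : A} {xs} → x ∉ xs → All (x ≢_) xs
∉⇒All≢ {xs = []}    _ = []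
∉⇒All≢ {xs = _ ∷ _} q = (λ e → q (here e)) ∷ ∉⇒All≢ (q ∘ there)

⊆-both : ∀ {A : Set} {x : A} {xs ys} → x ∈ ys → (∀ {z} → z ∈ xs → z ∈ ys) →
         ∀ {z} → z ∈ x ∷ xs → z ∈ ys
⊆-both p _ (here refl) = p
⊆-both _ q (there z∈)  = q z∈

data Cover {A : Set} (xs ys : List A) : Set where
  full   : (∀ {y} → y ∈ ys → y ∈ xs) → Cover xs ys
  except : ∀ z → z ∈ ys → (∀ {y} → y ∈ ys → y ≡ z ⊎ y ∈ xs) → Cover xs ys

module _ {A : Set} (_≟_ : DecidableEquality A) where
  open DecMembership _≟_ using (_∈?_)

  unique-cover : ∀ {xs ys : List A} → Unique xs → (∀ {z} → z ∈ xs → z ∈ ys) →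
                 length ys ≤ suc (length xs) → Cover xs ys
  unique-cover {xs} {ys} u xs⊆ys len with All.all? (_∈? xs) ys
  ... | yes q = full (All.lookup q)
  ... | no ¬q with missing ys ¬q
    where
    missing : ∀ zs → ¬ All (_∈ xs) zs → ∃ λ z → z ∈ zs × z ∉ xs
    missing [] ¬p = contradiction [] ¬p
    missing (z ∷ zs) ¬p with z ∈? xs
    ... | no z∉ = z , here refl , z∉
    ... | yes z∈ with missing zs (λ ps → ¬p (z∈ ∷ ps))
    ...   | w , w∈ , w∉ = w , there w∈ , w∉
  ... | z , z∈ , z∉ = except z z∈ rest
    where
    rest : ∀ {y} → y ∈ ys → y ≡ z ⊎ y ∈ xs
    rest {y} y∈ with y ≟ z | y ∈? xs
    ... | yes e | _      = inj₁ e
    ... | no _  | yes q  = inj₂ q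
    ... | no ne | no y∉ = ⊥-elim (ℕ.<-irrefl refl (≤-trans
          (unique-⊆-length ((ne ∷ ∉⇒All≢ y∉) ∷ ∉⇒All≢ z∉ ∷ u) (⊆-both y∈ (⊆-both z∈ xs⊆ys))) len))

  unique-exact : ∀ {xs ys : List A} → Unique xs → (∀ {z} → z ∈ xs → z ∈ ys) →
                 length ys ≤ length xs → ∀ {y} → y ∈ ys → y ∈ xs
  unique-exact {xs} u xs⊆ys len {y} y∈ with y ∈? xs
  ... | yes q = q
  ... | no y∉ = ⊥-elim (ℕ.<-irrefl refl (≤-trans
          (unique-⊆-length (∉⇒All≢ y∉ ∷ u) (⊆-both y∈ xs⊆ys)) len))

-- Edges as vertex sets

infix 4 _∈ᵉ_
_∈ᵉ_ : ∀ {k} → ℕ → Edge k → Set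
v ∈ᵉ x = v Vec.∈ vertices x

vertices-injective : ∀ {k} {x y : Edge k} → vertices x ≡ vertices y → x ≡ y
vertices-injective refl = refl

_≟ᵉ_ : ∀ {k} → DecidableEquality (Edge k)
x ≟ᵉ y = map′ vertices-injective (cong vertices) (V.≡-dec ℕ._≟_ (vertices x) (vertices y))

head-min : ∀ {n x} {xs : Vec ℕ n} → Linked _<_ (x ∷ xs) → ∀ {v} → v Vec.∈ xs → x < v
head-min {xs = _ ∷ _} (x< ∷ l) v∈ = VAll.lookup (Linked⇒All <-trans x< l) v∈

linked-tail : ∀ {n x} {xs : Vec ℕ n} → Linked _<_ (x ∷ xs) → Linked _<_ xs
linked-tail [-]     = []
linked-tail (_ ∷ l) = l

-- Equal lengths make one inclusion enough. An entry of the tail of `xs` cannot be the head `y`,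
-- because `y` is at most `x`; so the tails agree by induction, and then the heads.
increasing-⊆ : ∀ {n} {xs ys : Vec ℕ n} → Linked _<_ xs → Linked _<_ ys →
               (∀ {v} → v Vec.∈ xs → v Vec.∈ ys) → xs ≡ ys
increasing-⊆ {xs = []}     {[]}     _ _ _ = refl
increasing-⊆ {xs = x ∷ xs} {y ∷ ys} lx ly sub
  with increasing-⊆ (linked-tail lx) (linked-tail ly) tails
  where
  y≤ : ∀ {v} → v Vec.∈ y ∷ ys → y ≤ v
  y≤ (VAny.here refl) = ℕ.≤-refl
  y≤ (VAny.there v∈)  = ℕ.<⇒≤ (head-min ly v∈)
  tails : ∀ {v} → v Vec.∈ xs → v Vec.∈ ys
  tails v∈ with sub (VAny.there v∈)
  ... | VAny.there v∈ys  = v∈ys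
  ... | VAny.here refl   =
    contradiction (≤-trans (head-min lx v∈) (y≤ (sub (VAny.here refl)))) (<-irrefl refl)
... | refl with sub (VAny.here refl)
...   | VAny.here refl  = refl
...   | VAny.there x∈xs = contradiction (head-min lx x∈xs) (<-irrefl refl)

edge-⊆ : ∀ {k} {x y : Edge k} → (∀ {v} → v ∈ᵉ x → v ∈ᵉ y) → x ≡ y
edge-⊆ {x = edge xs lx} {edge ys ly} sub = vertices-injective
  -- The order proofs inside edges are irrelevant; being decidable, they can be recovered.
  (increasing-⊆ (recompute (Linked.linked? ℕ._<?_ xs) lx) (recompute (Linked.linked? ℕ._<?_ ys) ly) sub)

insert : ∀ {n} → ℕ → Vec ℕ n → Vec ℕ (suc n)
insert x []       = x ∷ []
insert x (y ∷ ys) with x ℕ.<? y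
... | yes _ = x ∷ y ∷ ys
... | no  _ = y ∷ insert x ys

sort : ∀ {n} → Vec ℕ n → Vec ℕ n
sort []       = []
sort (x ∷ xs) = insert x (sort xs)

∈-insert⁻ : ∀ {n x v} (ys : Vec ℕ n) → v Vec.∈ insert x ys → v ≡ x ⊎ v Vec.∈ ys
∈-insert⁻ [] (VAny.here e) = inj₁ e
∈-insert⁻ {x = x} (y ∷ ys) v∈ with x ℕ.<? y | v∈
... | yes _ | VAny.here e   = inj₁ e
... | yes _ | VAny.there q  = inj₂ q
... | no  _ | VAny.here e   = inj₂ (VAny.here e)
... | no  _ | VAny.there q  with ∈-insert⁻ ys q
...   | inj₁ e = inj₁ e
...   | inj₂ r = inj₂ (VAny.there r)

∈-insert⁺ : ∀ {n} x {v} (ys : Vec ℕ n) → v Vec.∈ x ∷ ys → v Vec.∈ insert x ys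
∈-insert⁺ x [] v∈ = v∈
∈-insert⁺ x (y ∷ ys) v∈ with x ℕ.<? y | v∈
... | yes _ | q                          = q
... | no  _ | VAny.here e                = VAny.there (∈-insert⁺ x ys (VAny.here e))
... | no  _ | VAny.there (VAny.here e)   = VAny.here e
... | no  _ | VAny.there (VAny.there q)  = VAny.there (∈-insert⁺ x ys (VAny.there q))

∈-sort⁻ : ∀ {n v} (xs : Vec ℕ n) → v Vec.∈ sort xs → v Vec.∈ xs
∈-sort⁻ (x ∷ xs) v∈ with ∈-insert⁻ (sort xs) v∈
... | inj₁ e = VAny.here e
... | inj₂ q = VAny.there (∈-sort⁻ xs q)

∈-sort⁺ : ∀ {n v} (xs : Vec ℕ n) → v Vec.∈ xs → v Vec.∈ sort xs
∈-sort⁺ (x ∷ xs) (VAny.here e)  = ∈-insert⁺ x (sort xs) (VAny.here e)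
∈-sort⁺ (x ∷ xs) (VAny.there q) = ∈-insert⁺ x (sort xs) (VAny.there (∈-sort⁺ xs q))

cons-linked : ∀ {n y} {xs : Vec ℕ n} → (∀ {v} → v Vec.∈ xs → y < v) → Linked _<_ xs →
              Linked _<_ (y ∷ xs)
cons-linked {xs = []}    _ _ = [-]
cons-linked {xs = _ ∷ _} q l = q (VAny.here refl) ∷ l

insert-linked : ∀ {n x} {ys : Vec ℕ n} → ¬ (x Vec.∈ ys) → Linked _<_ ys → Linked _<_ (insert x ys)
insert-linked {ys = []} _ _ = [-]
insert-linked {x = x} {y ∷ ys} x∉ l with x ℕ.<? y
... | yes x<y = x<y ∷ l
... | no x≮y  = cons-linked y< (insert-linked (x∉ ∘ VAny.there) (linked-tail l))
  where
  y< : ∀ {v} → v Vec.∈ insert x ys → y < v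
  y< v∈ with ∈-insert⁻ ys v∈
  ... | inj₁ refl = ℕ.≤∧≢⇒< (ℕ.≮⇒≥ x≮y) (λ e → x∉ (VAny.here (sym e)))
  ... | inj₂ q    = head-min l q

sort-linked : ∀ {n} {xs : Vec ℕ n} → VU.Unique xs → Linked _<_ (sort xs)
sort-linked VAP.[] = []
sort-linked {xs = x ∷ xs} (x∉ VAP.∷ u) =
  insert-linked (λ x∈ → VAll.lookup x∉ (∈-sort⁻ xs x∈) refl) (sort-linked u)

sortEdge : ∀ {k} (xs : Vec ℕ k) → .(VU.Unique xs) → Edge k
sortEdge xs u = edge (sort xs) (sort-linked u)

-- Drawing by maintaining an invariant

opponent-involutive : ∀ p → opponent (opponent p) ≡ p
opponent-involutive FP = refl
opponent-involutive SP = refl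

opponent-≢ : ∀ p → p ≢ opponent p
opponent-≢ FP ()
opponent-≢ SP ()

turn : ∀ p q → q ≡ p ⊎ q ≡ opponent p
turn FP FP = inj₁ refl
turn FP SP = inj₂ refl
turn SP SP = inj₁ refl
turn SP FP = inj₂ refl

claimed-own : ∀ {k} p x (h : History k) → toMove h ≡ p → claimed p (x ∷ h) ≡ x ∷ claimed p h
claimed-own p x h e with toMove h | p | e
... | FP | FP | refl = refl
... | SP | SP | refl = refl

claimed-other : ∀ {k} p x (h : History k) → toMove h ≡ opponent p → claimed p (x ∷ h) ≡ claimed p h
claimed-other p x h e with toMove h | p | e
... | FP | SP | refl = refl
... | SP | FP | refl = refl

∈-claimed : ∀ {k} p {e} (h : History k) → e ∈ h → e ∈ claimed p h ⊎ e ∈ claimed (opponent p) h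
∈-claimed p (x ∷ h) e∈ with turn p (toMove h)
... | inj₁ t rewrite claimed-own p x h t | claimed-other (opponent p) x h (trans t (sym (opponent-involutive p))) = own e∈
  where
  own : ∀ {e} → e ∈ x ∷ h → e ∈ x ∷ claimed p h ⊎ e ∈ claimed (opponent p) h
  own (here eq)  = inj₁ (here eq)
  own (there e∈) = [ inj₁ ∘ there , inj₂ ]′ (∈-claimed p h e∈)
... | inj₂ t rewrite claimed-other p x h t | claimed-own (opponent p) x h t = other e∈
  where
  other : ∀ {e} → e ∈ x ∷ h → e ∈ claimed p h ⊎ e ∈ x ∷ claimed (opponent p) h
  other (here eq)  = inj₂ (here eq)
  other (there e∈) = [ inj₁ , inj₂ ∘ there ]′ (∈-claimed p h e∈)

claimed-∈ : ∀ {k} p {e} (h : History k) → e ∈ claimed p h → e ∈ h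
claimed-∈ p (x ∷ h) e∈ with turn p (toMove h)
... | inj₁ t rewrite claimed-own p x h t = own e∈
  where
  own : ∀ {e} → e ∈ x ∷ claimed p h → e ∈ x ∷ h
  own (here eq)  = here eq
  own (there e∈) = there (claimed-∈ p h e∈)
... | inj₂ t rewrite claimed-other p x h t = there (claimed-∈ p h e∈)

_≟ʰ_ : ∀ {k} (h h′ : History k) → Dec (h ≡ h′)
_≟ʰ_ = L.≡-dec _≟ᵉ_

versus-own : ∀ {k} p {q} (σ τ : Strategy k) → q ≡ p → versus p σ τ q ≡ σ
versus-own FP σ τ refl = refl
versus-own SP σ τ refl = refl

versus-other : ∀ {k} p {q} (σ τ : Strategy k) → q ≡ opponent p → versus p σ τ q ≡ τ
versus-other FP σ τ refl = refl
versus-other SP σ τ refl = refl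

-- `A` already contains the attacker's last move. Once the defender owns the first copy nothing has
-- to be maintained, so `win` asks for no invariant.
data Reply {k} (H : Hypergraph k) (Quiet : List (Edge k) → List (Edge k) → Set)
           (A B : List (Edge k)) : Set where
  continue : ∀ y → y ∉ A → y ∉ B → Quiet A (y ∷ B) → Reply H Quiet A B
  win      : ∀ y → y ∉ A → y ∉ B → ContainsCopy H (y ∷ B) → Reply H Quiet A B

module Draw {k} (H : Hypergraph k) (p : Player)
            (spare : ∀ (h : History k) → Σ (Edge k) (_∉ h))
            (Quiet : List (Edge k) → List (Edge k) → Set) where

  Copies Free : List (Edge k) → Set
  Copies = ContainsCopy H
  Free A = ¬ Copies A

  -- Play goes on after a win, so the moment at which the defender was first is remembered: it
  -- refutes `Wins` for the attacker at that time and at every later one.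
  data Won : History k → Set where
    now   : ∀ {h} → Copies (claimed (opponent p) h) → Free (claimed p h) → Won h
    later : ∀ {x h} → Won h → Won (x ∷ h)

  data Good (h : History k) : Set where
    attacking : toMove h ≡ p → Free (claimed p h) → Quiet (claimed p h) (claimed (opponent p) h) → Good h
    defending : toMove h ≡ opponent p → Free (claimed p h) → Reply H Quiet (claimed p h) (claimed (opponent p) h) → Good h
    won       : Won h → Good h

  Step : Set
  Step = ∀ {A B} → Quiet A B → ∀ x → x ∉ A → x ∉ B → Free (x ∷ A) × Reply H Quiet (x ∷ A) B

  module _ (step : Step) (σ : Strategy k) where

    unclaimed : ∀ {y : Edge k} (h : History k) → y ∉ claimed p h → y ∉ claimed (opponent p) h → y ∉ h
    unclaimed h n m = [ n , m ]′ ∘ ∈-claimed p h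

    respond : ∀ {h} → Good h → Σ (Edge k) (_∉ h)
    respond {h} (defending _ _ (continue y n m _)) = y , unclaimed h n m
    respond {h} (defending _ _ (win y n m _))      = y , unclaimed h n m
    respond {h} (attacking _ _ _)                  = spare h
    respond {h} (won _)                            = spare h

    move : ∀ {h} → Good h → Σ (Edge k) (_∉ h)
    move {h} G with turn p (toMove h)
    ... | inj₁ _ = σ h
    ... | inj₂ _ = respond G

    good-move : ∀ {h} (G : Good h) → Good (proj₁ (move G) ∷ h)
    good-move {h} G with turn p (toMove h)
    good-move {h} (attacking t _ q) | inj₁ _ with σ h
    ... | x , x∉ = defending (cong opponent t)
            (subst Free (sym (claimed-own p x h t)) (proj₁ next))
            (subst (λ A → Reply H Quiet A (claimed (opponent p) (x ∷ h))) (sym (claimed-own p x h t))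
              (subst (Reply H Quiet (x ∷ claimed p h))
                (sym (claimed-other (opponent p) x h (trans t (sym (opponent-involutive p)))))
                (proj₂ next)))
      where next = step q x (x∉ ∘ claimed-∈ p h) (x∉ ∘ claimed-∈ (opponent p) h)
    good-move (defending t _ _) | inj₁ t′ = contradiction (trans (sym t′) t) (opponent-≢ p)
    good-move (won w) | inj₁ _ = won (later w)
    good-move (attacking t _ _) | inj₂ t′ = contradiction (trans (sym t) t′) (opponent-≢ p)
    good-move {h} (defending t free (continue y _ _ q)) | inj₂ _ =
      attacking (trans (cong opponent t) (opponent-involutive p))
        (subst Free (sym (claimed-other p y h t)) free)
        (subst (λ A → Quiet A (claimed (opponent p) (y ∷ h))) (sym (claimed-other p y h t))
          (subst (Quiet (claimed p h)) (sym (claimed-own (opponent p) y h t)) q))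
    good-move {h} (defending t free (win y _ _ c)) | inj₂ _ =
      won (now (subst Copies (sym (claimed-own (opponent p) y h t)) c)
               (subst Free (sym (claimed-other p y h t)) free))
    good-move (won w) | inj₂ _ = won (later w)

    module _ (start : Good []) where

      -- The defender's choices depend on data of the invariant that a bare history does not carry,
      -- so the play against `σ` is built together with its invariants before the strategy is
      -- defined.
      line : ℕ → Σ (History k) Good
      line zero    = [] , start
      line (suc n) = let (h , G) = line n in proj₁ (move G) ∷ h , good-move G

      -- Only the answers along the play against σ matter.
      defence : Strategy k
      defence h with h ≟ʰ proj₁ (line (length h))
      ... | yes e = proj₁ (respond (proj₂ (line (length h)))) ,
                    subst (proj₁ (respond (proj₂ (line (length h)))) ∉_) (sym e) (proj₂ (respond (proj₂ (line (length h)))))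
      ... | no _  = spare h

      defence-line : ∀ n → length (proj₁ (line n)) ≡ n →
                     proj₁ (defence (proj₁ (line n))) ≡ proj₁ (respond (proj₂ (line n)))
      defence-line n e with proj₁ (line n) ≟ʰ proj₁ (line (length (proj₁ (line n))))
      ... | yes _ = cong (λ m → proj₁ (respond (proj₂ (line m)))) e
      ... | no ne = contradiction (cong (proj₁ ∘ line) (sym e)) ne

      length-line : ∀ n → length (proj₁ (line n)) ≡ n
      length-line zero    = refl
      length-line (suc n) = cong suc (length-line n)

      chosen : ∀ n → let (h , G) = line n in
               proj₁ (versus p σ defence (toMove h) h) ≡ proj₁ (move G)
      chosen n with turn p (toMove (proj₁ (line n)))
      ... | inj₁ t = cong (λ ρ → proj₁ (ρ (proj₁ (line n)))) (versus-own p σ defence t)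
      ... | inj₂ t = trans (cong (λ ρ → proj₁ (ρ (proj₁ (line n)))) (versus-other p σ defence t))
                           (defence-line n (length-line n))

      play-line : ∀ n → play (versus p σ defence) n ≡ proj₁ (line n)
      play-line zero    = refl
      play-line (suc n) = trans
        (cong (λ h → proj₁ (versus p σ defence (toMove h) h) ∷ h) (play-line n))
        (cong (_∷ proj₁ (line n)) (chosen n))

      drawn : Wins H p (versus p σ defence) → ⊥
      drawn (n , copy , none) = go (subst Good (sym (play-line n)) (proj₂ (line n)))
        where
        s = versus p σ defence
        earlier : ∀ {h} n → h ≡ play s n → Won h →
          ∃ λ m → m ≤ n × Copies (claimed (opponent p) (play s m)) × Free (claimed p (play s m))
        earlier n e (now c f) = n , ℕ.≤-refl , subst (Copies ∘ claimed (opponent p)) e c , subst (Free ∘ claimed p) e f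
        earlier (suc n) e (later w) with earlier n (L.∷-injectiveʳ e) w
        ... | m , m≤n , cf = m , ℕ.m≤n⇒m≤1+n m≤n , cf
        go : Good (play s n) → ⊥
        go (attacking _ free _) = free copy
        go (defending _ free _) = free copy
        go (won w) with earlier n refl w
        ... | m , m≤n , c , free with ℕ.m≤n⇒m<n∨m≡n m≤n
        ...   | inj₁ m<n  = none m m<n c
        ...   | inj₂ refl = free copy

-- The hypergraph

Vertex Index : Set
Vertex = Fin 11
Index  = Fin 10

-- The edges 0 to 7 form the core; z lies in the spokes r and g only.  The twins 0 and 1 are
-- interchangeable in the core up to edge 6, the twins 2 and 3 up to edge 7.
pattern z = suc 9F
pattern r = 8F
pattern g = 9F

opaque
  -- Edge i, for i up to 5, brings in the vertex 4 + i and no later one; the building phase relies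
  -- on this numbering. Edge 6 contains 0 but not 1, edge 7 contains 2 but not 3.
  table : Vec (Vec Vertex 5) 10
  table = (0F ∷ 1F ∷ 2F ∷ 3F ∷ 4F ∷ [])
        ∷ (0F ∷ 1F ∷ 2F ∷ 3F ∷ 5F ∷ [])
        ∷ (0F ∷ 1F ∷ 4F ∷ 5F ∷ 6F ∷ [])
        ∷ (2F ∷ 3F ∷ 5F ∷ 6F ∷ 7F ∷ [])
        ∷ (0F ∷ 1F ∷ 4F ∷ 7F ∷ 8F ∷ [])
        ∷ (2F ∷ 3F ∷ 6F ∷ 8F ∷ 9F ∷ [])
        ∷ (0F ∷ 4F ∷ 7F ∷ 8F ∷ 9F ∷ [])
        ∷ (2F ∷ 4F ∷ 6F ∷ 7F ∷ 9F ∷ [])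
        ∷ (0F ∷ 2F ∷ 5F ∷ 9F ∷ z ∷ [])
        ∷ (0F ∷ 2F ∷ 7F ∷ 8F ∷ z ∷ [])
        ∷ []

  corners : Index → Vec Vertex 5
  corners = lookup table

infix 4 _∈ᶜ_ _∈ᶜ?_
_∈ᶜ_ : Vertex → Index → Set
y ∈ᶜ i = y Vec.∈ corners i

_∈ᶜ?_ : ∀ y i → Dec (y ∈ᶜ i)
y ∈ᶜ? i = VAny.any? (y F.≟_) (corners i)

opaque
  unfolding corners

  -- The indices a, b, c are edges that are missing or unknown.
  separated : ∀ y y′ a b → y ≡ y′ ⊎ ∃ λ i → i ≢ a × i ≢ b × (y ∈ᶜ i × ¬ y′ ∈ᶜ i ⊎ ¬ y ∈ᶜ i × y′ ∈ᶜ i)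
  separated = from-yes (all? λ y → all? λ y′ → all? λ a → all? λ b → (y F.≟ y′) ⊎-dec any? λ i →
    ¬? (i F.≟ a) ×-dec ¬? (i F.≟ b) ×-dec ((y ∈ᶜ? i ×-dec ¬? (y′ ∈ᶜ? i)) ⊎-dec (¬? (y ∈ᶜ? i) ×-dec y′ ∈ᶜ? i)))

  degree : ∀ y a b c → y ≡ z ⊎ ∃ λ i → i ≢ a × i ≢ b × i ≢ c × y ∈ᶜ i
  degree = from-yes (all? λ y → all? λ a → all? λ b → all? λ c → (y F.≟ z) ⊎-dec any? λ i →
    ¬? (i F.≟ a) ×-dec ¬? (i F.≟ b) ×-dec ¬? (i F.≟ c) ×-dec y ∈ᶜ? i)

  corners-unique : ∀ i → VU.Unique (corners i)
  corners-unique = from-yes (all? λ i → VAP.allPairs? (λ x y → ¬? (x F.≟ y)) (corners i))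

  corner-list-unique : ∀ i → Unique (toList (corners i))
  corner-list-unique = from-yes (all? λ i → unique? (toList (corners i)))

  corners-antichain : ∀ i j → i ≡ j ⊎ ∃ λ y → y ∈ᶜ i × ¬ y ∈ᶜ j
  corners-antichain = from-yes (all? λ i → all? λ j → (i F.≟ j) ⊎-dec any? λ y → y ∈ᶜ? i ×-dec ¬? (y ∈ᶜ? j))

-- Rigidity through the sizes of pairwise intersections

meet : Index → Index → ℕ
meet i j = length (filter (_∈ᶜ? j) (toList (corners i)))

Sizes : Set
Sizes = Vec (Vec ℕ 10) 10

opaque
  sizes : Sizes
  sizes = V.tabulate λ i → V.tabulate (meet i)

  lookup-sizes : ∀ i j → lookup (lookup sizes i) j ≡ meet i j
  lookup-sizes i j = trans
    (cong (λ v → lookup v j) (V.lookup∘tabulate (λ i → V.tabulate (meet i)) i))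
    (V.lookup∘tabulate (meet i) j)

fits : Sizes → Index → Index → List (Index × Index) → Bool
fits m i t []              = true
fits m i t ((j , u) ∷ asg) = (lookup (lookup m i) j ≡ᵇ lookup (lookup m t) u) ∧ fits m i t asg

-- Backtracking, cut off at the first intersection size that disagrees. This also enforces
-- injectivity: a repeated value has intersection size 5 with itself, which distinct edges never
-- have.
search : Sizes → List Index → List (Index × Index) → Bool
search m []         asg = all (λ (i , t) → does (i F.≟ t)) asg
search m (i ∷ todo) asg = all (λ t → not (fits m i t asg) ∨ search m todo ((i , t) ∷ asg)) (allFin 10)

others : List Index → List Index
others xs = filter (λ i → ¬? (Any.any? (i F.≟_) xs)) (allFin 10)

-- Only the identity embeds the edges outside xs into the edges of H with all sizes of
-- pairwise intersections preserved.
Rigid : List Index → Set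
Rigid xs = T (search sizes (others xs) [])

opaque
  unfolding corners sizes

  rigid-pair : ∀ a b → Rigid (a ∷ b ∷ [])
  rigid-pair = from-yes (all? λ a → all? λ b → T? (search sizes (others (a ∷ b ∷ [])) []))

  rigid-core : ∀ a → Rigid (r ∷ g ∷ a ∷ [])
  rigid-core = from-yes (all? λ a → T? (search sizes (others (r ∷ g ∷ a ∷ [])) []))

all-sound : ∀ {A : Set} {p : A → Bool} {xs x} → T (all p xs) → x ∈ xs → T (p x)
all-sound {p = p} {x ∷ xs} t (here refl) = proj₁ (Equivalence.to T-∧ t)
all-sound {p = p} {x ∷ xs} t (there x∈)  = all-sound {p = p} (proj₂ (Equivalence.to (T-∧ {p x}) t)) x∈

all-complete : ∀ {A : Set} {p : A → Bool} {xs} → T (all p xs) → All (T ∘ p) xs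
all-complete t = All.tabulate (all-sound t)

module _ (π : Index → Index) (L : List Index)
         (meets : ∀ {i j} → i ∈ L → j ∈ L → meet i j ≡ meet (π i) (π j)) where

  Assigned : Index × Index → Set
  Assigned (i , t) = i ∈ L × t ≡ π i

  fits-complete : ∀ {i} → i ∈ L → ∀ {asg} → All Assigned asg → T (fits sizes i (π i) asg)
  fits-complete i∈ [] = tt
  fits-complete {i} i∈ {(j , _) ∷ _} ((j∈ , refl) ∷ as) = Equivalence.from T-∧
    ( ℕ.≡⇒≡ᵇ _ _ (trans (lookup-sizes i j) (trans (meets i∈ j∈) (sym (lookup-sizes (π i) (π j)))))
    , fits-complete i∈ as)

  -- The branch that follows `π` is never cut off, since `π` preserves the sizes; its leaf certifies
  -- that `π` is the identity.
  search-sound : ∀ todo {asg} → T (search sizes todo asg) → All (_∈ L) todo → All Assigned asg →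
                 All (λ i → π i ≡ i) todo × All (λ (i , t) → i ≡ t) asg
  search-sound [] t [] as = [] , All.map (λ {(i , u)} → conv i u) (all-complete t)
    where
    conv : ∀ i u → T (does (i F.≟ u)) → i ≡ u
    conv i u q with i F.≟ u
    ... | yes e = e
  search-sound (i ∷ todo) {asg} t (i∈ ∷ todo∈) as
    with Equivalence.to (T-∨ {not (fits sizes i (π i) asg)}) (all-sound {p = λ t → not (fits sizes i t asg) ∨ search sizes todo ((i , t) ∷ asg)} t (∈-allFin (π i)))
  ... | inj₁ q = ⊥-elim (T-not q (fits-complete i∈ as))
    where
    T-not : ∀ {b} → T (not b) → T b → ⊥
    T-not {true} ()
  ... | inj₂ q with search-sound todo q todo∈ ((i∈ , refl) ∷ as)
  ...   | ps , (e ∷ qs) = (sym e ∷ ps) , qs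

-- Copies and rigidity

record Copy : Set where
  constructor copy
  field
    at        : Vertex → ℕ
    injective : ∀ {x y} → at x ≡ at y → x ≡ y

open Copy public

opaque
  img : Copy → Index → Edge 5
  img f i = sortEdge (V.map (at f) (corners i)) (VU.map⁺ (injective f) (corners-unique i))

  ∈-img⁺ : ∀ f {y i} → y ∈ᶜ i → at f y ∈ᵉ img f i
  ∈-img⁺ f y∈ = ∈-sort⁺ _ (V∈.∈-map⁺ (at f) y∈)

  ∈-map⁻′ : ∀ {n} (h : Vertex → ℕ) {v} (xs : Vec Vertex n) → v Vec.∈ V.map h xs → ∃ λ y → y Vec.∈ xs × v ≡ h y
  ∈-map⁻′ h (x ∷ xs) (VAny.here e)  = x , VAny.here refl , e
  ∈-map⁻′ h (x ∷ xs) (VAny.there p) with ∈-map⁻′ h xs p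
  ... | y , y∈ , e = y , VAny.there y∈ , e

  ∈-img⁻ : ∀ f {v i} → v ∈ᵉ img f i → ∃ λ y → y ∈ᶜ i × v ≡ at f y
  ∈-img⁻ f {i = i} v∈ = ∈-map⁻′ (at f) (corners i) (∈-sort⁻ _ v∈)

∈-img : ∀ f {y i} → at f y ∈ᵉ img f i → y ∈ᶜ i
∈-img f {i = i} y∈ with ∈-img⁻ f y∈
... | y , y∈′ , e = subst (_∈ᶜ i) (sym (injective f e)) y∈′

img-⊆ : ∀ f i {x : Edge 5} → (∀ y → y ∈ᶜ i → at f y ∈ᵉ x) → img f i ≡ x
img-⊆ f i {x} sub = edge-⊆ λ v∈ → let (y , y∈ , e) = ∈-img⁻ f v∈ in subst (_∈ᵉ x) (sym e) (sub y y∈)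

img-cong : ∀ f h {i} → (∀ y → y ∈ᶜ i → at f y ≡ at h y) → img f i ≡ img h i
img-cong f h {i} eq = img-⊆ f i λ y y∈ → subst (_∈ᵉ img h i) (sym (eq y y∈)) (∈-img⁺ h y∈)

img-injective : ∀ f {i j} → img f i ≡ img f j → i ≡ j
img-injective f {i} {j} e with corners-antichain i j
... | inj₁ eq = eq
... | inj₂ (y , y∈ , y∉) = contradiction (∈-img f (subst (at f y ∈ᵉ_) e (∈-img⁺ f y∈))) y∉

common : Index → Index → List Vertex
common i j = filter (_∈ᶜ? j) (toList (corners i))

common-unique : ∀ i j → Unique (common i j)
common-unique i j = Unique.filter⁺ (_∈ᶜ? j) (corner-list-unique i)

-- Intersection sizes can be read off the edges alone, whichever copy they are seen in. Exchanging
-- the roles of the copies gives equality.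
meet-≤ : ∀ f h {i j t u} → img h i ≡ img f t → img h j ≡ img f u → meet i j ≤ meet t u
meet-≤ f h {i} {j} {t} {u} ei ej = subst₂ _≤_ (L.length-map (at h) (common i j)) (L.length-map (at f) (common t u))
  (unique-⊆-length (Unique.map⁺ (injective h) (common-unique i j)) sub)
  where
  sub : ∀ {v} → v ∈ L.map (at h) (common i j) → v ∈ L.map (at f) (common t u)
  sub v∈ with ∈-map⁻ (at h) v∈
  ... | y , y∈ , refl with ∈-filter⁻ (_∈ᶜ? j) {xs = toList (corners i)} y∈
  ...   | y∈i , y∈j with ∈-img⁻ f (subst (at h y ∈ᵉ_) ei (∈-img⁺ h (V∈.∈-toList⁻ y∈i)))
  ...     | w , w∈t , e = subst (_∈ _) (sym e) (∈-map⁺ (at f) (∈-filter⁺ (_∈ᶜ? u) (V∈.∈-toList⁺ w∈t)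
              (∈-img f (subst (_∈ᵉ img f u) e (subst (at h y ∈ᵉ_) ej (∈-img⁺ h y∈j))))))

-- The hypothesis defines a map of indices that preserves intersection sizes, so the finite search
-- forces it to be the identity.
rigid : ∀ f h {xs} → Rigid xs → (∀ i → i ∉ xs → ∃ λ t → img h i ≡ img f t) →
        ∀ i → i ∉ xs → img h i ≡ img f i
rigid f h {xs} rig into i i∉ = result (Any.any? (i F.≟_) xs)
  where
  choose : ∀ j → Dec (j ∈ xs) → Index
  choose j (yes _)  = j
  choose j (no j∉) = proj₁ (into j j∉)
  π : Index → Index
  π j = choose j (Any.any? (j F.≟_) xs)
  not-in : ∀ {j} → j ∈ others xs → j ∉ xs
  not-in = proj₂ ∘ ∈-filter⁻ (λ j → ¬? (Any.any? (j F.≟_) xs)) {xs = allFin 10}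
  π-img : ∀ j → j ∉ xs → img h j ≡ img f (π j)
  π-img j j∉ with Any.any? (j F.≟_) xs
  ... | yes j∈ = contradiction j∈ j∉
  ... | no q   = proj₂ (into j q)
  meets : ∀ {i j} → i ∈ others xs → j ∈ others xs → meet i j ≡ meet (π i) (π j)
  meets i∈ j∈ = ℕ.≤-antisym
    (meet-≤ f h (π-img _ (not-in i∈)) (π-img _ (not-in j∈)))
    (meet-≤ h f (sym (π-img _ (not-in i∈))) (sym (π-img _ (not-in j∈))))
  result : Dec (i ∈ xs) → img h i ≡ img f i
  result (yes i∈) = contradiction i∈ i∉
  result (no _)   = trans (π-img i i∉) (cong (img f) (All.lookup
    (proj₁ (search-sound π (others xs) meets (others xs) rig (All.tabulate id) []))
    (∈-filter⁺ (λ j → ¬? (Any.any? (j F.≟_) xs)) (∈-allFin i) i∉)))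

-- Core and spokes

Side : Set
Side = Fin 2

spoke : Side → Index
spoke 0F = r
spoke 1F = g

mate : Side → Side
mate 0F = 1F
mate 1F = 0F

Core : Index → Set
Core i = i ≢ r × i ≢ g

swap : Fin 3 → Vertex → Vertex
swap 1F 0F = 1F
swap 1F 1F = 0F
swap 2F 2F = 3F
swap 2F 3F = 2F
swap _  y  = y

-- For s ≢ 0F, the only core edge that swap s does not map to itself; last 0F is a dummy value.
last : Fin 3 → Index
last 0F = r
last 1F = 6F
last 2F = 7F

open DecMembership (F._≟_ {11}) using (_∈?_)

petal : Side → List Vertex
petal b = filter (λ y → ¬? (y F.≟ z)) (toList (corners (spoke b)))

-- Intersection and union of the two petals; their lengths 2 and 6 are the bounds in `overlaps`.
shared joined : List Vertex
shared = 0F ∷ 2F ∷ []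
joined = 0F ∷ 2F ∷ 5F ∷ 7F ∷ 8F ∷ 9F ∷ []

petal′ : Fin 3 → Side → List Vertex
petal′ s b = L.map (swap s) (petal b)

inter union : Fin 3 → Side → Fin 3 → Side → List Vertex
inter s b s′ b′ = filter (λ y → y ∈? petal′ s′ b′) (petal′ s b)
union s b s′ b′ = petal′ s b L.++ filter (λ y → ¬? (y ∈? petal′ s b)) (petal′ s′ b′)

opaque
  unfolding corners

  swap-involutive : ∀ s y → swap s (swap s y) ≡ y
  swap-involutive = from-yes (all? λ s → all? λ y → swap s (swap s y) F.≟ y)

  swap-commute : ∀ s s′ y → swap s (swap s′ y) ≡ swap s′ (swap s y)
  swap-commute = from-yes (all? λ s → all? λ s′ → all? λ y → swap s (swap s′ y) F.≟ swap s′ (swap s y))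

  two-moved : ∀ s y v → swap s y ≢ y → swap s v ≢ v → v ≡ y ⊎ v ≡ swap s y
  two-moved = from-yes (all? λ s → all? λ y → all? λ v → ¬? (swap s y F.≟ y) →-dec (¬? (swap s v F.≟ v) →-dec
    ((v F.≟ y) ⊎-dec (v F.≟ swap s y))))

  -- In the core, vertices other than z can be confused only if they are twins and the single edge
  -- that tells them apart is missing. The case `s ≡ 0F` is that of equal vertices.
  separated-core : ∀ a y y′ → y ≡ z ⊎ (∃ λ s → y′ ≡ swap s y × (s ≡ 0F ⊎ a ≡ last s × y′ ≢ y)) ⊎
    ∃ λ i → i ≢ r × i ≢ g × i ≢ a × (y ∈ᶜ i × ¬ y′ ∈ᶜ i ⊎ ¬ y ∈ᶜ i × y′ ∈ᶜ i)
  separated-core = from-yes (all? λ a → all? λ y → all? λ y′ → (y F.≟ z) ⊎-dec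
    (any? λ s → (y′ F.≟ swap s y) ×-dec ((s F.≟ 0F) ⊎-dec ((a F.≟ last s) ×-dec ¬? (y′ F.≟ y)))) ⊎-dec
    any? λ i → ¬? (i F.≟ r) ×-dec ¬? (i F.≟ g) ×-dec ¬? (i F.≟ a) ×-dec
      ((y ∈ᶜ? i ×-dec ¬? (y′ ∈ᶜ? i)) ⊎-dec (¬? (y ∈ᶜ? i) ×-dec y′ ∈ᶜ? i)))

  -- Without the spokes the vertices 5, 8 and 9 keep only three edges, so just two exceptional edges
  -- are affordable here.
  degree-core : ∀ y a b → y ≡ z ⊎ ∃ λ i → i ≢ r × i ≢ g × i ≢ a × i ≢ b × y ∈ᶜ i
  degree-core = from-yes (all? λ y → all? λ a → all? λ b → (y F.≟ z) ⊎-dec any? λ i →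
    ¬? (i F.≟ r) ×-dec ¬? (i F.≟ g) ×-dec ¬? (i F.≟ a) ×-dec ¬? (i F.≟ b) ×-dec y ∈ᶜ? i)

  z∈spoke : ∀ b → z ∈ᶜ spoke b
  z∈spoke = from-yes (all? λ b → z ∈ᶜ? spoke b)

  z∈⇒spoke : ∀ i → z ∈ᶜ i → i ≡ r ⊎ i ≡ g
  z∈⇒spoke = from-yes (all? λ i → (z ∈ᶜ? i) →-dec ((i F.≟ r) ⊎-dec (i F.≟ g)))

  -- The last alternative is a genuine exception to the counting: the same spoke under the two
  -- swaps, such as 1, 2, 5, 9 and 0, 3, 5, 9, also meets in two vertices and covers six.
  overlaps : ∀ s b s′ b′ → 2 < length (inter s b s′ b′) ⊎ 6 < length (union s b s′ b′) ⊎
             (s ≡ s′ × b′ ≡ mate b) ⊎ (s ≢ s′ × s ≢ 0F × s′ ≢ 0F)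
  overlaps = from-yes (all? λ s → all? λ b → all? λ s′ → all? λ b′ →
    (2 ℕ.<? length (inter s b s′ b′)) ⊎-dec (6 ℕ.<? length (union s b s′ b′)) ⊎-dec ((s F.≟ s′) ×-dec (b′ F.≟ mate b)) ⊎-dec
    (¬? (s F.≟ s′) ×-dec ¬? (s F.≟ 0F) ×-dec ¬? (s′ F.≟ 0F)))

  inter-unique : ∀ s b s′ b′ → Unique (inter s b s′ b′)
  inter-unique = from-yes (all? λ s → all? λ b → all? λ s′ → all? λ b′ → unique? (inter s b s′ b′))

  union-unique : ∀ s b s′ b′ → Unique (union s b s′ b′)
  union-unique = from-yes (all? λ s → all? λ b → all? λ s′ → all? λ b′ → unique? (union s b s′ b′))

  petal-meet : ∀ y → y ∈ petal 0F → y ∈ petal 1F → y ∈ shared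
  petal-meet = from-yes (all? λ y → (y ∈? petal 0F) →-dec (y ∈? petal 1F) →-dec (y ∈? shared))

  petal-join : ∀ b y → y ∈ petal b → y ∈ joined
  petal-join = from-yes (all? λ b → all? λ y → (y ∈? petal b) →-dec (y ∈? joined))

  swap-core : ∀ s i → i ≢ r → i ≢ g → i ≢ last s → ∀ y → y ∈ᶜ i → swap s y ∈ᶜ i
  swap-core = from-yes (all? λ s → all? λ i → ¬? (i F.≟ r) →-dec ¬? (i F.≟ g) →-dec ¬? (i F.≟ last s) →-dec
    all? λ y → y ∈ᶜ? i →-dec swap s y ∈ᶜ? i)

  swap-last : ∀ s → s ≢ 0F → ∃ λ y → y ∈ᶜ last s × ¬ swap s y ∈ᶜ last s
  swap-last = from-yes (all? λ s → ¬? (s F.≟ 0F) →-dec any? λ y → y ∈ᶜ? last s ×-dec ¬? (swap s y ∈ᶜ? last s))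

  -- Vertex 8 of edge 6 and vertex 6 of edge 7 serve as witnesses. Hence a single extra edge cannot
  -- account for both swaps, which settles the exception in `overlaps`.
  last-clash : ∀ s s′ → s ≢ s′ → s ≢ 0F → s′ ≢ 0F →
               ∃ λ y → y ∈ᶜ last s × swap s y ≡ y × ¬ y ∈ᶜ last s′ × swap s′ y ≡ y
  last-clash = from-yes (all? λ s → all? λ s′ → ¬? (s F.≟ s′) →-dec ¬? (s F.≟ 0F) →-dec ¬? (s′ F.≟ 0F) →-dec
    any? λ y → y ∈ᶜ? last s ×-dec swap s y F.≟ y ×-dec ¬? (y ∈ᶜ? last s′) ×-dec swap s′ y F.≟ y)

  old-corner : ∀ (i : Fin 6) k y → toℕ k < toℕ i → y ∈ᶜ k → toℕ y < 4 + toℕ i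
  old-corner = from-yes (all? {6} λ i → all? λ k → all? λ y → (toℕ k ℕ.<? toℕ i) →-dec (y ∈ᶜ? k) →-dec (toℕ y ℕ.<? (4 + toℕ i)))

  new-corner : ∀ (i : Fin 6) k → toℕ k ≡ toℕ i → ∃ λ y → y ∈ᶜ k × 4 + toℕ i ≤ toℕ y
  new-corner = from-yes (all? {6} λ i → all? λ k → (toℕ k ℕ.≟ toℕ i) →-dec any? λ y → (y ∈ᶜ? k) ×-dec ((4 + toℕ i) ℕ.≤? toℕ y))

  nine∈last : ∀ s → s ≢ 0F → 9F ∈ᶜ last s
  nine∈last = from-yes (all? λ s → ¬? (s F.≟ 0F) →-dec (9F ∈ᶜ? last s))

  others-unique : ∀ k → Unique (others (k ∷ []))
  others-unique = from-yes (all? λ k → AP.allPairs? (λ i j → ¬? (i F.≟ j)) (others (k ∷ [])))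

  others-length : ∀ k → length (others (k ∷ [])) ≡ 9
  others-length = from-yes (all? λ k → length (others (k ∷ [])) ℕ.≟ 9)

coreList : List Index
coreList = others (r ∷ g ∷ [])

opaque
  core-unique : Unique coreList
  core-unique = from-yes (AP.allPairs? (λ i j → ¬? (i F.≟ j)) coreList)

  coreList-core : ∀ i → i ∈ coreList → Core i
  coreList-core = from-yes (all? λ i → Any.any? (i F.≟_) coreList →-dec (¬? (i F.≟ r) ×-dec ¬? (i F.≟ g)))

rigid₂ : ∀ f h a b → (∀ i → i ≢ a → i ≢ b → ∃ λ t → img h i ≡ img f t) →
         ∀ i → i ≢ a → i ≢ b → img h i ≡ img f i
rigid₂ f h a b into i i≢a i≢b = rigid f h (rigid-pair a b)
  (λ j j∉ → into j (j∉ ∘ here) (j∉ ∘ there ∘ here)) i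
  λ { (here e) → i≢a e ; (there (here e)) → i≢b e }

rigid₃ : ∀ f h a → (∀ i → Core i → i ≢ a → ∃ λ t → img h i ≡ img f t) →
         ∀ i → Core i → i ≢ a → img h i ≡ img f i
rigid₃ f h a into i (i≢r , i≢g) i≢a = rigid f h (rigid-core a)
  (λ j j∉ → into j (j∉ ∘ here , j∉ ∘ there ∘ here) (j∉ ∘ there ∘ there ∘ here)) i
  λ { (here e) → i≢r e ; (there (here e)) → i≢g e ; (there (there (here e))) → i≢a e }

match : ∀ f h {i y} → img h i ≡ img f i → y ∈ᶜ i → ∃ λ y′ → at h y ≡ at f y′ × y′ ∈ᶜ i
match f h {i} {y} e y∈ with ∈-img⁻ f (subst (at h y ∈ᵉ_) e (∈-img⁺ h y∈))
... | y′ , y′∈ , eq = y′ , eq , y′∈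

match⁺ : ∀ f h {i y y′} → img h i ≡ img f i → at h y ≡ at f y′ → y ∈ᶜ i → y′ ∈ᶜ i
match⁺ f h {i} e eq y∈ = ∈-img f (subst (_∈ᵉ img f i) eq (subst (_ ∈ᵉ_) e (∈-img⁺ h y∈)))

-- Two candidates for the image of `y` would be separated by an edge other than `a` and `b`, on
-- which both copies agree.
agree₂ : ∀ f h a b → (∀ i → i ≢ a → i ≢ b → img h i ≡ img f i) →
         ∀ {y i} → i ≢ a → i ≢ b → y ∈ᶜ i → at h y ≡ at f y
agree₂ f h a b same {y} {i} i≢a i≢b y∈ with match f h (same i i≢a i≢b) y∈
... | y′ , eq , _ with separated y y′ a b
...   | inj₁ refl = eq
...   | inj₂ (j , j≢a , j≢b , inj₁ (in₁ , out)) = contradiction (match⁺ f h (same j j≢a j≢b) eq in₁) out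
...   | inj₂ (j , j≢a , j≢b , inj₂ (out , in₂)) =
        contradiction (match⁺ h f (sym (same j j≢a j≢b)) (sym eq) in₂) out

Within : Copy → Edge 5 → Copy → Set
Within f x h = ∀ i → Core i → (∃ λ t → img h i ≡ img f t) ⊎ img h i ≡ x

Swapped : Copy → Fin 3 → Copy → Set
Swapped f s h = ∀ y → y ≢ z → at h y ≡ at f (swap s y)

module _ (f h : Copy) (a : Index) (same : ∀ i → Core i → i ≢ a → img h i ≡ img f i) where

  vertexwise : ∀ y → y ≢ z → ∃ λ y′ → at h y ≡ at f y′ × ∃ λ s → y′ ≡ swap s y × (s ≡ 0F ⊎ a ≡ last s × y′ ≢ y)
  vertexwise y y≢z with degree-core y a a
  ... | inj₁ e = contradiction e y≢z
  ... | inj₂ (i , i≢r , i≢g , i≢a , _ , y∈) with match f h (same i (i≢r , i≢g) i≢a) y∈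
  ...   | y′ , eq , _ with separated-core a y y′
  ...     | inj₁ e = contradiction e y≢z
  ...     | inj₂ (inj₁ found) = y′ , eq , found
  ...     | inj₂ (inj₂ (j , j≢r , j≢g , j≢a , inj₁ (in₁ , out))) =
            contradiction (match⁺ f h (same j (j≢r , j≢g) j≢a) eq in₁) out
  ...     | inj₂ (inj₂ (j , j≢r , j≢g , j≢a , inj₂ (out , in₂))) =
            contradiction (match⁺ h f (sym (same j (j≢r , j≢g) j≢a)) (sym eq) in₂) out

  -- Injectivity propagates a swap of one of the twins to the other.
  swapped : ∃ λ s → Swapped f s h × (s ≡ 0F ⊎ a ≡ last s)
  swapped with any? (λ y → ¬? (y F.≟ z) ×-dec ¬? (at h y ℕ.≟ at f y))
  ... | no none = 0F , (λ y y≢z → decidable-stable (at h y ℕ.≟ at f y) (λ ne → none (y , y≢z , ne))) , inj₁ refl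
  ... | yes (y , y≢z , ne) with vertexwise y y≢z
  ...   | .y , eq , _ , refl , inj₁ refl = contradiction eq ne
  ...   | y′ , eq , s , refl , inj₂ (a≡ , y′≢y) = s , all-swapped , inj₂ a≡
    where
    last-injective : ∀ s s′ → last s ≡ last s′ → s ≡ s′
    last-injective 0F 0F _ = refl
    last-injective 1F 1F _ = refl
    last-injective 0F 1F ()
    last-injective 0F 2F ()
    last-injective 1F 0F ()
    last-injective 1F 2F ()
    last-injective 2F 0F ()
    last-injective 2F 1F ()
    last-injective 2F 2F _ = refl
    all-swapped : Swapped f s h
    all-swapped v v≢z with vertexwise v v≢z
    ... | v′ , eqv , s′ , e′ , inj₂ (a≡′ , _) =
          trans eqv (cong (at f) (trans e′ (cong (λ s → swap s v) (last-injective s′ s (trans (sym a≡′) a≡)))))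
    ... | .v , eqv , .0F , refl , inj₁ refl with swap s v F.≟ v
    ...   | yes fixed = trans eqv (cong (at f) (sym fixed))
    ...   | no moved with two-moved s y v y′≢y moved
    ...     | inj₁ refl = contradiction eqv ne
    ...     | inj₂ refl = contradiction (injective h (trans eqv (sym eq))) y′≢y

Hits : Copy → Edge 5 → Fin 3 → Set
Hits h x s = s ≡ 0F ⊎ img h (last s) ≡ x

-- Only one core edge of `h` can lie outside `f`, namely `x`. Rigidity fixes the others, and the
-- vertices are then determined up to the twins that this one edge tells apart.
near : ∀ f x h → Within f x h → ∃ λ s → Swapped f s h × Hits h x s
near f x h within with any? (λ i → ¬? (i F.≟ r) ×-dec ¬? (i F.≟ g) ×-dec ¬? (any? λ t → img h i ≟ᵉ img f t))
-- No core edge is exceptional here; `r` stands in for one and rules out a proper swap.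
... | no none with swapped f h r (λ i c _ → rigid₃ f h r (λ j (j≢r , j≢g) _ → decidable-stable
        (any? λ t → img h j ≟ᵉ img f t) (λ ne → none (j , j≢r , j≢g , ne))) i c (proj₁ c))
...   | s , sw , hit = s , sw , [ inj₁ , (λ e → inj₁ (last-r s e)) ]′ hit
  where
  last-r : ∀ s → r ≡ last s → s ≡ 0F
  last-r 0F _ = refl
  last-r 1F ()
  last-r 2F ()
near f x h within | yes (i₀ , i₀≢r , i₀≢g , missing)
  with swapped f h i₀ (rigid₃ f h i₀ into)
  where
  hit : img h i₀ ≡ x
  hit = [ (λ q → contradiction q missing) , id ]′ (within i₀ (i₀≢r , i₀≢g))
  into : ∀ i → Core i → i ≢ i₀ → ∃ λ t → img h i ≡ img f t
  into i c i≢ with within i c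
  ... | inj₁ q = q
  ... | inj₂ e = contradiction (img-injective h (trans e (sym hit))) i≢
... | s , sw , inj₁ e = s , sw , inj₁ e
... | s , sw , inj₂ refl with within (last s) (i₀≢r , i₀≢g)
...   | inj₁ q = contradiction q missing
...   | inj₂ e = s , sw , inj₂ e

Inside : Copy → Side → Copy → Side → Set
Inside h b d b′ = ∀ y → y ∈ᶜ spoke b → y ≢ z → ∃ λ y′ → y′ ∈ᶜ spoke b′ × y′ ≢ z × at h y ≡ at d y′

petal⁻ : ∀ b {y} → y ∈ petal b → y ∈ᶜ spoke b × y ≢ z
petal⁻ b y∈ with ∈-filter⁻ (λ y → ¬? (y F.≟ z)) y∈
... | y∈′ , y≢z = V∈.∈-toList⁻ y∈′ , y≢z

petal⁺ : ∀ b {y} → y ∈ᶜ spoke b → y ≢ z → y ∈ petal b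
petal⁺ b y∈ y≢z = ∈-filter⁺ (λ y → ¬? (y F.≟ z)) (V∈.∈-toList⁺ y∈) y≢z

inside-petal′ : ∀ f h d {s} b b′ → Swapped f s h → Inside h b d b′ → ∀ {v} → v ∈ petal′ s b →
                ∃ λ w → w ∈ petal b′ × at f v ≡ at d w
inside-petal′ f h d {s} b b′ sw ins v∈ with ∈-map⁻ (swap s) v∈
... | y , y∈ , refl with petal⁻ b y∈
...   | y∈ᶜ , y≢z with ins y y∈ᶜ y≢z
...     | w , w∈ , w≢z , e = w , petal⁺ b′ w∈ w≢z , trans (sym (sw y y≢z)) e

length-≤ : ∀ f d {xs ys : List Vertex} → Unique xs → (∀ {v} → v ∈ xs → ∃ λ w → w ∈ ys × at f v ≡ at d w) →
           length xs ≤ length ys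
length-≤ f d {xs} {ys} u sub = subst₂ _≤_ (L.length-map (at f) xs) (L.length-map (at d) ys)
  (unique-⊆-length (Unique.map⁺ (injective f) u) λ v∈ → into (∈-map⁻ (at f) v∈))
  where
  into : ∀ {v} → (∃ λ y → y ∈ xs × v ≡ at f y) → v ∈ L.map (at d) ys
  into (y , y∈ , refl) with sub y∈
  ... | w , w∈ , e = subst (_∈ _) (sym e) (∈-map⁺ (at d) w∈)

-- The spokes of d without z meet in two vertices and cover six; up to the choice of h and k,
-- which differ from f by at most a twin swap, no other pair of spokes does so.
spokes-paired : ∀ f x h k d b b′ → Within f x h → Within f x k →
                Inside h b d 1F → Inside k b′ d 0F → Inside h (mate b) d 0F
spokes-paired f x h k d b b′ wh wk ih ik with near f x h wh | near f x k wk
... | s , sh , hith | s′ , sk , hitk with overlaps s b s′ b′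
...   | inj₁ big = contradiction (length-≤ f d (inter-unique s b s′ b′) sub) (ℕ.<⇒≱ big)
  where
  sub : ∀ {v} → v ∈ inter s b s′ b′ → ∃ λ w → w ∈ shared × at f v ≡ at d w
  sub v∈ with ∈-filter⁻ (λ y → y ∈? petal′ s′ b′) {xs = petal′ s b} v∈
  ... | v∈₁ , v∈₂ with inside-petal′ f h d b 1F sh ih v∈₁ | inside-petal′ f k d b′ 0F sk ik v∈₂
  ...   | w , w∈ , e | w′ , w′∈ , e′ = w , petal-meet w (subst (_∈ petal 0F) (injective d (trans (sym e′) e)) w′∈) w∈ , e
...   | inj₂ (inj₁ big) = contradiction (length-≤ f d (union-unique s b s′ b′) sub) (ℕ.<⇒≱ big)
  where
  sub : ∀ {v} → v ∈ union s b s′ b′ → ∃ λ w → w ∈ joined × at f v ≡ at d w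
  sub v∈ with ∈-++⁻ (petal′ s b) v∈
  ... | inj₁ v∈₁ with inside-petal′ f h d b 1F sh ih v∈₁
  ...   | w , w∈ , e = w , petal-join 1F w w∈ , e
  sub v∈ | inj₂ v∈₂ with inside-petal′ f k d b′ 0F sk ik (proj₁ (∈-filter⁻ (λ y → ¬? (y ∈? petal′ s b)) {xs = petal′ s′ b′} v∈₂))
  ...   | w , w∈ , e = w , petal-join 0F w w∈ , e
-- Here `h` and `k` agree off z, and the spoke of `k` is the mate of that of `h`.
...   | inj₂ (inj₂ (inj₁ (refl , refl))) = λ y y∈ y≢z →
        let (w , w∈ , w≢z , e) = ik y y∈ y≢z
        in w , w∈ , w≢z , trans (trans (sh y y≢z) (sym (sk y y≢z))) e
...   | inj₂ (inj₂ (inj₂ (s≢s′ , s≢0 , s′≢0))) with hith | hitk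
...     | inj₁ e | _      = contradiction e s≢0
...     | _      | inj₁ e = contradiction e s′≢0
...     | inj₂ e | inj₂ e′ with last-clash s s′ s≢s′ s≢0 s′≢0
...       | y , y∈ , fix , y∉ , fix′ with y F.≟ z
...         | yes refl = ⊥-elim ([ last≢r s s≢0 , last≢g s ]′ (z∈⇒spoke (last s) y∈))
  where
  last≢r : ∀ s → s ≢ 0F → last s ≢ r
  last≢r 0F ne _ = ne refl
  last≢r 1F _ ()
  last≢r 2F _ ()
  last≢g : ∀ s → last s ≢ g
  last≢g 0F ()
  last≢g 1F ()
  last≢g 2F ()
...         | no y≢z = contradiction (∈-img k (subst (_∈ᵉ img k (last s′)) same (subst (at h y ∈ᵉ_) (trans e (sym e′)) (∈-img⁺ h y∈)))) y∉
  where
  same : at h y ≡ at k y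
  same = trans (sh y y≢z) (trans (cong (at f) (trans fix (sym fix′))) (sym (sk y y≢z)))

-- Threats

Edges : Set
Edges = List (Edge 5)

open DecMembership (_≟ᵉ_ {5}) using () renaming (_∈?_ to _∈ˡ?_)

Disjoint : Edges → Edges → Set
Disjoint A B = ∀ {e} → e ∈ A → e ∉ B

Off : Copy → ℕ → Set
Off f ζ = ∀ y → y ≢ z → at f y ≢ ζ

relocate : ∀ f ζ → Off f ζ → Copy
relocate f ζ off = copy (λ y → pick y (y F.≟ z)) (λ {x} {y} → inj x y (x F.≟ z) (y F.≟ z))
  where
  pick : ∀ y → Dec (y ≡ z) → ℕ
  pick y (yes _) = ζ
  pick y (no _)  = at f y
  inj : ∀ x y (p : Dec (x ≡ z)) (q : Dec (y ≡ z)) → pick x p ≡ pick y q → x ≡ y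
  inj x y (yes e) (yes e′) _  = trans e (sym e′)
  inj x y (yes _) (no y≢z) eq = contradiction (sym eq) (off y y≢z)
  inj x y (no x≢z) (yes _) eq = contradiction eq (off x x≢z)
  inj x y (no _)  (no _)   eq = injective f eq

relocate-≢z : ∀ f ζ off y → y ≢ z → at (relocate f ζ off) y ≡ at f y
relocate-≢z f ζ off y y≢z with y F.≟ z
... | yes e = contradiction e y≢z
... | no _  = refl

core-≢z : ∀ {i y} → Core i → y ∈ᶜ i → y ≢ z
core-≢z {i} (i≢r , i≢g) y∈ refl = [ i≢r , i≢g ]′ (z∈⇒spoke i y∈)

img-relocate : ∀ f ζ off {i} → Core i → img (relocate f ζ off) i ≡ img f i
img-relocate f ζ off c = img-cong (relocate f ζ off) f λ y y∈ → relocate-≢z f ζ off y (core-≢z c y∈)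

off∉core : ∀ f {ζ i} → Off f ζ → Core i → ¬ ζ ∈ᵉ img f i
off∉core f off c ζ∈ with ∈-img⁻ f ζ∈
... | y , y∈ , e = off y (core-≢z c y∈) (sym e)

off∈relocate : ∀ f {ζ ζ′ i} → Off f ζ → (off′ : Off f ζ′) → ζ ∈ᵉ img (relocate f ζ′ off′) i → ζ ≡ ζ′
off∈relocate f {ζ′ = ζ′} off off′ ζ∈ with ∈-img⁻ (relocate f ζ′ off′) ζ∈
... | y , _ , e with y F.≟ z
...   | yes _  = e
...   | no y≢z = contradiction (sym e) (off y y≢z)

spoke-mate : ∀ b → spoke b ≢ spoke (mate b)
spoke-mate 0F ()
spoke-mate 1F ()

core-or-spoke : ∀ i → Core i ⊎ ∃ λ b → i ≡ spoke b
core-or-spoke i with i F.≟ r | i F.≟ g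
... | yes e | _     = inj₂ (0F , e)
... | no _  | yes e = inj₂ (1F , e)
... | no n  | no m  = inj₁ (n , m)

spoke-cases : ∀ b c → c ≡ b ⊎ c ≡ mate b
spoke-cases 0F 0F = inj₁ refl
spoke-cases 0F 1F = inj₂ refl
spoke-cases 1F 0F = inj₂ refl
spoke-cases 1F 1F = inj₁ refl

mate-mate : ∀ b → mate (mate b) ≡ b
mate-mate 0F = refl
mate-mate 1F = refl

-- The edge `img h k` may itself belong to `A`, so that results on threats also exclude complete
-- copies.
Threat : Edges → Copy → Index → Set
Threat A h k = ∀ i → i ≢ k → img h i ∈ A

CoreIn : Edges → Copy → Set
CoreIn A h = ∀ i → Core i → img h i ∈ A

data Omitted (A : Edges) (x : Edge 5) (h : Copy) (k : Index) : Set where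
  omitted : ∀ j → (∀ i → i ≢ k → i ≢ j → img h i ∈ A) → j ≡ k ⊎ img h j ≡ x → Omitted A x h k

tail-of : ∀ {A : Edges} {x e} → e ∈ x ∷ A → e ≢ x → e ∈ A
tail-of (here e)   ne = contradiction e ne
tail-of (there e∈) _  = e∈

-- The move `x` supplies at most one edge of `h`; when it supplies none, `j` repeats `k`.
threat-omitted : ∀ {A x} h k → Threat (x ∷ A) h k → Omitted A x h k
threat-omitted {A} {x} h k th with any? (λ j → img h j ≟ᵉ x)
... | yes (j , e) = omitted j (λ i i≢k i≢j → tail-of (th i i≢k) λ e′ → i≢j (img-injective h (trans e′ (sym e)))) (inj₂ e)
... | no none     = omitted k (λ i i≢k _ → tail-of (th i i≢k) λ e → none (i , e)) (inj₁ refl)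

-- Off two omitted edges `h` coincides with `f`, and degrees extend this to all vertices but z. So
-- `img h k` is the defender's `img f k`; as neither `A` nor `x` supplies it, it is the missing edge
-- of the threat.
blocked-threats : ∀ {A B x} f k → Core k → Disjoint (x ∷ A) B →
  (∀ {a} → a ∈ A → ∃ λ i → i ≢ k × a ≡ img f i) → img f k ∈ B →
  ∀ h k′ → Threat (x ∷ A) h k′ → img h k′ ∈ B
blocked-threats {A} {B} {x} f k ck dis A⊆ kB h k′ th with threat-omitted h k′ th
... | omitted j inA hit = finish (k F.≟ k′) (k F.≟ j)
  where
  same : ∀ i → i ≢ k′ → i ≢ j → img h i ≡ img f i
  same = rigid₂ f h k′ j λ i i≢k′ i≢j → let (t , _ , e) = A⊆ (inA i i≢k′ i≢j) in t , e
  img-k : img h k ≡ img f k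
  img-k = img-cong h f λ y y∈ → agree y y∈ (degree y k′ j j)
    where
    agree : ∀ y → y ∈ᶜ k → (y ≡ z ⊎ ∃ λ i → i ≢ k′ × i ≢ j × i ≢ j × y ∈ᶜ i) → at h y ≡ at f y
    agree y y∈ (inj₁ e) = contradiction e (core-≢z ck y∈)
    agree y _ (inj₂ (i , i≢k′ , i≢j , _ , y∈)) = agree₂ f h k′ j same i≢k′ i≢j y∈
  finish : Dec (k ≡ k′) → Dec (k ≡ j) → img h k′ ∈ B
  finish (yes refl) _ = subst (_∈ B) (sym img-k) kB
  finish (no k≢k′) (yes refl) = ⊥-elim ([ k≢k′
    , (λ e → dis (here refl) (subst (_∈ B) (trans (sym img-k) e) kB)) ]′ hit)
  finish (no k≢k′) (no k≢j) with A⊆ (inA k k≢k′ k≢j)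
  ... | t , t≢k , e = contradiction (img-injective f (trans (sym e) (same k k≢k′ k≢j))) t≢k

-- A threat on the core of f that the opponent, the owner of B, has answered.
Star : Copy → Edges → Edge 5 → Set
Star f B a = ∃ λ ζ → Σ (Off f ζ) λ off → ∃ λ b →
  a ≡ img (relocate f ζ off) (spoke b) × img (relocate f ζ off) (spoke (mate b)) ∈ B

CoreEdge : Copy → Edge 5 → Set
CoreEdge f a = ∃ λ i → Core i × a ≡ img f i

coreEdge? : ∀ f a → Dec (CoreEdge f a)
coreEdge? f a = any? λ i → (¬? (i F.≟ r) ×-dec ¬? (i F.≟ g)) ×-dec (a ≟ᵉ img f i)

Starry : Copy → Edges → Edges → Set
Starry f A B = ∀ {a} → a ∈ A → CoreEdge f a ⊎ Star f B a

module _ {A B : Edges} (f : Copy) (starry : Starry f A B) (dis : Disjoint A B) where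

  -- A vertex off the core lies in just two candidate edges, and the opponent owns one of them.
  star-unique : ∀ {ζ} (off : Off f ζ) b → img (relocate f ζ off) (spoke (mate b)) ∈ B →
                ∀ {a} → a ∈ A → ζ ∈ᵉ a → a ≡ img (relocate f ζ off) (spoke b)
  star-unique {ζ} off b inB a∈ ζ∈ with starry a∈
  ... | inj₁ (i , c , refl) = contradiction ζ∈ (off∉core f off c)
  ... | inj₂ (ζ′ , off′ , b′ , refl , _) with off∈relocate f off off′ ζ∈
  ...   | refl with spoke-cases b b′
  ...     | inj₁ refl = img-cong (relocate f ζ off′) (relocate f ζ off) λ _ _ → refl
  ...     | inj₂ refl = contradiction
            (subst (_∈ B) (img-cong (relocate f ζ off) (relocate f ζ off′) λ _ _ → refl) inB) (dis a∈)

  -- The new vertex of a star is private to one edge of `h`. Lower bounds on degrees will force it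
  -- to be z or give a contradiction.
  star-vertex : ∀ h {i} → img h i ∈ A → ¬ CoreEdge f (img h i) →
    ∃ λ y → y ∈ᶜ i × ∀ j → y ∈ᶜ j → img h j ∈ A → j ≡ i
  star-vertex h {i} inA notcore with starry inA
  ... | inj₁ c = contradiction c notcore
  ... | inj₂ (ζ , off , b , e , inB) with ∈-img⁻ h (subst (ζ ∈ᵉ_) (sym e) (∈-img⁺ (relocate f ζ off) (z∈spoke b)))
  ...   | y , y∈ , refl = y , y∈ , λ j y∈j inA′ → img-injective h
          (trans (star-unique off b inB inA′ (∈-img⁺ h y∈j)) (sym e))

-- A star used as a core edge would have a vertex in no other edge of `A`. But that vertex has core
-- degree at least 3, and `x` accounts for only one more edge.
core-within : ∀ {A B x} f → Starry f A B → Disjoint (x ∷ A) B → ∀ h → CoreIn (x ∷ A) h → Within f x h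
core-within {A} {B} {x} f starry dis h inA i c with img h i ≟ᵉ x
... | yes e = inj₂ e
... | no ne with coreEdge? f (img h i)
...   | yes (t , _ , e) = inj₁ (t , e)
...   | no notcore with star-vertex f starry (dis ∘ there) h (tail-of (inA i c) ne) notcore
...     | y , y∈ , only with hits
  where
  hits : ∃ λ j → ∀ i → img h i ≡ x → i ≡ j
  hits with any? (λ j → img h j ≟ᵉ x)
  ... | yes (j , e) = j , λ i e′ → img-injective h (trans e′ (sym e))
  ... | no none     = i , λ i e → contradiction (i , e) none
...       | j , hits-only with degree-core y i j
...         | inj₁ e = contradiction e (core-≢z c y∈)
...         | inj₂ (t , t≢r , t≢g , t≢i , t≢j , y∈t) = contradiction
              (only t y∈t (tail-of (inA t (t≢r , t≢g)) (t≢j ∘ hits-only t))) t≢i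

NewStar : Copy → Edge 5 → Copy → Index → Set
NewStar f x h k = ∃ λ b → k ≡ spoke (mate b) × x ≡ img h (spoke b) × (∀ y → y ≢ z → at h y ≡ at f y)

-- If all edges of `h` but `k` and `j` are core edges of `f`, then `k` and `j` are the spokes and
-- `x` is one of them. Otherwise `h` uses an old star, whose private vertex must be z; so `h` is `f`
-- with z moved there, and its other spoke has already been taken by the defender.
starry-threats : ∀ {A B x} f → Starry f A B → Disjoint (x ∷ A) B →
  ∀ h k → Threat (x ∷ A) h k → img h k ∈ B ⊎ NewStar f x h k
starry-threats {A} {B} {x} f starry dis h k th with threat-omitted h k th
... | omitted j inA hit = split (any? λ i → ¬? (i F.≟ k) ×-dec ¬? (i F.≟ j) ×-dec ¬? (coreEdge? f (img h i)))
  where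
  NonCore : Index → Set
  NonCore i = i ≢ k × i ≢ j × ¬ CoreEdge f (img h i)

  private-vertex : ∀ {i} → NonCore i → z ∈ᶜ i × ∀ t → z ∈ᶜ t → t ≢ k → t ≢ j → t ≡ i
  private-vertex {i} (i≢k , i≢j , nc) with star-vertex f starry (dis ∘ there) h (inA i i≢k i≢j) nc
  ... | y , y∈ , only with degree y k j i
  ...   | inj₁ refl = y∈ , λ t z∈ t≢k t≢j → only t z∈ (inA t t≢k t≢j)
  ...   | inj₂ (t , t≢k , t≢j , t≢i , y∈t) = contradiction (only t y∈t (inA t t≢k t≢j)) t≢i

  split : Dec (∃ NonCore) → img h k ∈ B ⊎ NewStar f x h k
  split (no none) = inj₂ new
    where
    coreEdge : ∀ i → i ≢ k → i ≢ j → CoreEdge f (img h i)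
    coreEdge i i≢k i≢j = decidable-stable (coreEdge? f (img h i)) λ nc → none (i , i≢k , i≢j , nc)
    same : ∀ i → i ≢ k → i ≢ j → img h i ≡ img f i
    same = rigid₂ f h k j λ i i≢k i≢j → let (t , _ , e) = coreEdge i i≢k i≢j in t , e
    core : ∀ i → i ≢ k → i ≢ j → Core i
    core i i≢k i≢j with coreEdge i i≢k i≢j
    ... | t , c , e = subst Core (img-injective f (trans (sym e) (same i i≢k i≢j))) c
    spoke-not-core : ∀ b → ¬ Core (spoke b)
    spoke-not-core 0F c = proj₁ c refl
    spoke-not-core 1F c = proj₂ c refl
    spoke-omitted : ∀ b → spoke b ≡ k ⊎ spoke b ≡ j
    spoke-omitted b with spoke b F.≟ k | spoke b F.≟ j
    ... | yes e | _     = inj₁ e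
    ... | no _  | yes e = inj₂ e
    ... | no n  | no m  = contradiction (core (spoke b) n m) (spoke-not-core b)
    agree : ∀ y → y ≢ z → at h y ≡ at f y
    agree y y≢z with degree y k j j
    ... | inj₁ e = contradiction e y≢z
    ... | inj₂ (i , i≢k , i≢j , _ , y∈) = agree₂ f h k j same i≢k i≢j y∈
    new′ : ∀ b → spoke (mate b) ≡ k → spoke b ≡ j → NewStar f x h k
    new′ b e e′ = [ (λ j≡k → contradiction (trans e′ (trans j≡k (sym e))) (spoke-mate b))
      , (λ e″ → b , sym e , trans (sym e″) (cong (img h) (sym e′)) , agree) ]′ hit
    new : NewStar f x h k
    new with spoke-omitted 0F | spoke-omitted 1F
    ... | inj₁ e | inj₂ e′ = new′ 1F e e′
    ... | inj₂ e | inj₁ e′ = new′ 0F e′ e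
    ... | inj₁ e | inj₁ e′ = contradiction (trans e (sym e′)) (spoke-mate 0F)
    ... | inj₂ e | inj₂ e′ = contradiction (trans e (sym e′)) (spoke-mate 0F)
  split (yes (i₁ , nc₁@(i₁≢k , i₁≢j , notcore))) with starry (inA i₁ i₁≢k i₁≢j)
  ... | inj₁ c = contradiction c notcore
  ... | inj₂ (ζ , off , b , e₁ , inB) = inj₁ (finish (spoke (mate b) F.≟ k) (spoke (mate b) F.≟ j))
    where
    F = relocate f ζ off
    into : ∀ i → i ≢ k → i ≢ j → ∃ λ t → img h i ≡ img F t
    into i i≢k i≢j with coreEdge? f (img h i)
    ... | yes (t , c , e) = t , trans e (sym (img-relocate f ζ off c))
    ... | no nc = spoke b , trans (cong (img h) (proj₂ (private-vertex nc₁) i (proj₁ (private-vertex (i≢k , i≢j , nc))) i≢k i≢j)) e₁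
    same : ∀ i → i ≢ k → i ≢ j → img h i ≡ img F i
    same = rigid₂ F h k j into
    agree : ∀ y → at h y ≡ at F y
    agree y with degree y k j j
    ... | inj₁ refl = agree₂ F h k j same i₁≢k i₁≢j (proj₁ (private-vertex nc₁))
    ... | inj₂ (i , i≢k , i≢j , _ , y∈) = agree₂ F h k j same i≢k i≢j y∈
    partner : img h (spoke (mate b)) ∈ B
    partner = subst (_∈ B) (img-cong F h λ y _ → sym (agree y)) inB
    finish : Dec (spoke (mate b) ≡ k) → Dec (spoke (mate b) ≡ j) → img h k ∈ B
    finish (yes refl) _ = partner
    finish (no n) (no m) = contradiction partner (dis (there (inA _ n m)))
    finish (no n) (yes refl) = ⊥-elim ([ n , (λ e → dis (here refl) (subst (_∈ B) e partner)) ]′ hit)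

-- The edge on spoke b with which the attacker answered the claim, with a vertex ζ new to
-- the board, of the other spoke.
Answer : Copy → Side → Edges → Edges → Edge 5 → Set
Answer d b A₀ B a = ∃ λ ζ → Σ (Off d ζ) λ off → a ≡ img (relocate d ζ off) (spoke b) ×
  img (relocate d ζ off) (spoke (mate b)) ∈ B × (∀ {e} → e ∈ A₀ → ¬ ζ ∈ᵉ e)

-- If an answer on spoke b completes a threat for the attacker, then the missing edge is the
-- one that the defender claimed just before.
Harmless : Copy → Side → Edges → Set
Harmless d b A = ∀ h c → CoreIn A h → Inside h c d b → Inside h (mate c) d (mate b)

mate-cases : ∀ {i j} b → spoke b ≡ i ⊎ spoke b ≡ j → spoke (mate b) ≡ i ⊎ spoke (mate b) ≡ j →
             (spoke b ≡ i × spoke (mate b) ≡ j) ⊎ (spoke b ≡ j × spoke (mate b) ≡ i)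
mate-cases b (inj₁ p) (inj₂ q) = inj₁ (p , q)
mate-cases b (inj₂ p) (inj₁ q) = inj₂ (p , q)
mate-cases b (inj₁ p) (inj₁ q) = contradiction (trans p (sym q)) (spoke-mate b)
mate-cases b (inj₂ p) (inj₂ q) = contradiction (trans p (sym q)) (spoke-mate b)

-- If a threat uses an answer, the vertex `ζ` of that answer lies in no other edge of the threat
-- that the attacker owns, so `ζ` plays z and the core of the threat lies in `A₀`. Harmlessness then
-- identifies the missing spoke with the one that the defender claimed.
forced-threats : ∀ {A A₀ B} d b → (∀ h k → Threat A₀ h k → img h k ∈ B) → Harmless d b A₀ →
  (∀ {a} → a ∈ A → a ∈ A₀ ⊎ Answer d b A₀ B a) → ∀ h k → Threat A h k → img h k ∈ B
forced-threats {A} {A₀} {B} d b quiet harmless answers h k th =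
  split (any? λ i → ¬? (i F.≟ k) ×-dec ¬? (img h i ∈ˡ? A₀))
  where
  New : Index → Set
  New i = i ≢ k × img h i ∉ A₀

  answer : ∀ {i} → New i → Answer d b A₀ B (img h i)
  answer (i≢k , i∉) with answers (th _ i≢k)
  ... | inj₁ i∈ = contradiction i∈ i∉
  ... | inj₂ a  = a

  private-vertex : ∀ {i} → New i → z ∈ᶜ i × (∀ t → z ∈ᶜ t → t ≢ k → t ≡ i)
  private-vertex {i} new with answer new
  ... | ζ , off , e , _ , fresh with ∈-img⁻ h (subst (ζ ∈ᵉ_) (sym e) (∈-img⁺ (relocate d ζ off) (z∈spoke b)))
  ...   | y , y∈ , refl with degree y k i i
  ...     | inj₁ refl = y∈ , only
    where
    only : ∀ t → z ∈ᶜ t → t ≢ k → t ≡ i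
    only t z∈ t≢k with answers (th t t≢k)
    ... | inj₁ t∈ = contradiction (∈-img⁺ h z∈) (fresh t∈)
    ... | inj₂ (ζ′ , off′ , e′ , _) with off∈relocate d off off′ (subst (ζ ∈ᵉ_) e′ (∈-img⁺ h z∈))
    ...   | refl = img-injective h (trans e′ (trans (img-cong (relocate d ζ off′) (relocate d ζ off) λ _ _ → refl) (sym e)))
  ...     | inj₂ (t , t≢k , t≢i , _ , y∈t) with answers (th t t≢k)
  ...       | inj₁ t∈ = contradiction (∈-img⁺ h y∈t) (fresh t∈)
  ...       | inj₂ (ζ′ , off′ , e′ , _) with off∈relocate d off off′ (subst (ζ ∈ᵉ_) e′ (∈-img⁺ h y∈t))
  ...         | refl = contradiction (img-injective h (trans e′ (trans
                  (img-cong (relocate d ζ off′) (relocate d ζ off) λ _ _ → refl) (sym e)))) t≢i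

  split : Dec (∃ New) → img h k ∈ B
  split (no none) = quiet h k λ i i≢k → decidable-stable (img h i ∈ˡ? A₀) λ i∉ → none (i , i≢k , i∉)
  split (yes (i₁ , new)) = go (answer new) (spokes)
    where
    spoke-omitted : ∀ c → spoke c ≡ i₁ ⊎ spoke c ≡ k
    spoke-omitted c with spoke c F.≟ k
    ... | yes e = inj₂ e
    ... | no n  = inj₁ (proj₂ (private-vertex new) (spoke c) (z∈spoke c) n)
    spokes : ∃ λ c → spoke c ≡ i₁ × spoke (mate c) ≡ k
    spokes with mate-cases 0F (spoke-omitted 0F) (spoke-omitted 1F)
    ... | inj₁ (p , q) = 0F , p , q
    ... | inj₂ (p , q) = 1F , q , p
    not-core : ∀ c {i} → spoke c ≡ i → ¬ Core i
    not-core 0F refl (n , _) = n refl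
    not-core 1F refl (_ , n) = n refl
    go : Answer d b A₀ B (img h i₁) → (∃ λ c → spoke c ≡ i₁ × spoke (mate c) ≡ k) → img h k ∈ B
    go (ζ , off , e , inB , fresh) (c , refl , refl) = subst (_∈ B) (sym partner) inB
      where
      D = relocate d ζ off
      coreIn : CoreIn A₀ h
      coreIn i ci with img h i ∈ˡ? A₀
      ... | yes i∈ = i∈
      ... | no i∉ = contradiction refl (core-≢z ci (proj₁ (private-vertex (i≢k , i∉))))
        where
        i≢k : i ≢ spoke (mate c)
        i≢k eq = not-core (mate c) (sym eq) ci
      hz : at h z ≡ ζ
      hz with ∈-img⁻ h (subst (ζ ∈ᵉ_) (sym e) (∈-img⁺ D (z∈spoke b)))
      ... | y , y∈ , e′ with y F.≟ z
      ...   | yes refl = sym e′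
      ...   | no y≢z with ∈-img⁻ D (subst (at h z ∈ᵉ_) e (∈-img⁺ h (z∈spoke c)))
      ...     | w , _ , e″ with w F.≟ z
      ...       | yes _ = e″
      ...       | no w≢z with degree y (spoke (mate c)) (spoke c) (spoke c)
      ...         | inj₁ y≡z = contradiction y≡z y≢z
      ...         | inj₂ (t , t≢ , t≢′ , _ , y∈t) =
        contradiction (subst (_∈ᵉ img h t) (sym e′) (∈-img⁺ h y∈t)) (fresh (coreIn t (core t t≢ t≢′)))
        where
        core : ∀ t → t ≢ spoke (mate c) → t ≢ spoke c → Core t
        core t n m with core-or-spoke t
        ... | inj₁ ct = ct
        ... | inj₂ (c′ , refl) with spoke-cases c c′
        ...   | inj₁ refl = contradiction refl m
        ...   | inj₂ refl = contradiction refl n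
      inside : Inside h c d b
      inside y y∈ y≢z with ∈-img⁻ D (subst (at h y ∈ᵉ_) e (∈-img⁺ h y∈))
      ... | w , w∈ , e′ with w F.≟ z
      ...   | yes _  = contradiction (injective h (trans e′ (sym hz))) y≢z
      ...   | no w≢z = w , w∈ , w≢z , e′
      partner : img h (spoke (mate c)) ≡ img D (spoke (mate b))
      partner = img-⊆ h (spoke (mate c)) sub
        where
        sub : ∀ y → y ∈ᶜ spoke (mate c) → at h y ∈ᵉ img D (spoke (mate b))
        sub y y∈ with y F.≟ z
        ... | yes refl = subst (_∈ᵉ img D (spoke (mate b))) (sym hz) (∈-img⁺ D (z∈spoke (mate b)))
        ... | no y≢z with harmless h c coreIn inside y y∈ y≢z
        ...   | w , w∈ , w≢z , e′ = subst (_∈ᵉ img D (spoke (mate b)))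
                  (trans (relocate-≢z d ζ off w w≢z) (sym e′)) (∈-img⁺ D w∈)

-- Counting while the attacker has at most nine edges

edgesOf : Copy → List Index → Edges
edgesOf h = L.map (img h)

edgesOf-unique : ∀ h {is} → Unique is → Unique (edgesOf h is)
edgesOf-unique h = Unique.map⁺ (img-injective h)

-- A threat takes nine edges and so exhausts `A`: the first threat reveals the attacker's whole
-- position.
threat-exact : ∀ {A} h k → length A ≤ 9 → Threat A h k → ∀ {a} → a ∈ A → ∃ λ i → i ≢ k × a ≡ img h i
threat-exact {A} h k len th a∈ with ∈-map⁻ (img h)
  (unique-exact _≟ᵉ_ (edgesOf-unique h (others-unique k)) sub (≤-trans len (ℕ.≤-reflexive
    (sym (trans (L.length-map (img h) (others (k ∷ []))) (others-length k))))) a∈)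
  where
  sub : ∀ {e} → e ∈ edgesOf h (others (k ∷ [])) → e ∈ A
  sub e∈ with ∈-map⁻ (img h) e∈
  ... | i , i∈ , refl = th i λ e → proj₂ (∈-filter⁻ (λ j → ¬? (Any.any? (j F.≟_) (k ∷ []))) {xs = allFin 10} i∈) (here e)
... | i , i∈ , e = i , (λ e′ → proj₂ (∈-filter⁻ (λ j → ¬? (Any.any? (j F.≟_) (k ∷ []))) {xs = allFin 10} i∈) (here e′)) , e

core-cover : ∀ {A} h → length A ≤ 9 → CoreIn A h → ∃ λ x → ∀ k → CoreIn A k → Within h x k
core-cover {A} h len inA with unique-cover _≟ᵉ_ (edgesOf-unique h core-unique) sub (≤-trans len (ℕ.≤-reflexive
    (cong suc (sym (trans (L.length-map (img h) coreList) refl)))))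
  where
  sub : ∀ {e} → e ∈ edgesOf h coreList → e ∈ A
  sub e∈ with ∈-map⁻ (img h) e∈
  ... | i , i∈ , refl = inA i (coreList-core i i∈)
-- Nothing is left over besides the core, so any edge can serve as the exceptional one.
... | full q = img h 0F , λ k inA′ i c → let (t , _ , e) = ∈-map⁻ (img h) (q (inA′ i c)) in inj₁ (t , e)
... | except x _ q = x , λ k inA′ i c → [ inj₂ , (λ e∈ → let (t , _ , e) = ∈-map⁻ (img h) e∈ in inj₁ (t , e)) ]′ (q (inA′ i c))

-- Copies in the sense of the theorem as families of edges

opaque
  unfolding corners

  face : Index → Subset 11
  face i = V.tabulate (λ y → does (y ∈ᶜ? i))

  ∈-face⁺ : ∀ {y i} → y ∈ᶜ i → y Subset.∈ face i
  ∈-face⁺ {y} {i} y∈ = V.lookup⇒[]= y (face i)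
    (trans (V.lookup∘tabulate (λ y → does (y ∈ᶜ? i)) y) (dec-true (y ∈ᶜ? i) y∈))

  ∈-face⁻ : ∀ {y i} → y Subset.∈ face i → y ∈ᶜ i
  ∈-face⁻ {y} {i} y∈ = holds (y ∈ᶜ? i)
    (trans (sym (V.lookup∘tabulate (λ y → does (y ∈ᶜ? i)) y)) (V.[]=⇒lookup y∈))
    where
    holds : (p : Dec (y ∈ᶜ i)) → does p ≡ true → y ∈ᶜ i
    holds (yes q) _ = q

  face-size : ∀ i → ∣ face i ∣ ≡ 5
  face-size = from-yes (all? λ i → ∣ face i ∣ ℕ.≟ 5)

hypergraph : Hypergraph 5
hypergraph = record
  { order   = 11
  ; edges   = L.map face (allFin 10)
  ; uniform = All.map⁺ {f = face} (All.tabulate {xs = allFin 10} λ {i} _ → face-size i)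
  }

isImage : ∀ f i → IsImage (at f) (face i) (img f i)
isImage f i v = mk⇔
  (λ v∈ → let (y , y∈ , e) = ∈-img⁻ f v∈ in y , ∈-face⁺ y∈ , sym e)
  (λ (y , y∈ , e) → subst (_∈ᵉ img f i) e (∈-img⁺ f (∈-face⁻ y∈)))

contains⁺ : ∀ {A} f → (∀ i → img f i ∈ A) → ContainsCopy hypergraph A
contains⁺ f inA = at f , injective f , All.map⁺ {f = face} (All.tabulate {xs = allFin 10} λ {i} _ → lose (inA i) (isImage f i))

contains⁻ : ∀ {A} → ContainsCopy hypergraph A → ∃ λ f → ∀ i → img f i ∈ A
contains⁻ {A} (φ , inj , images) = f , λ i → found i (find (All.lookup images (∈-map⁺ face (∈-allFin i))))
  where
  f = copy φ inj
  found : ∀ i → (∃ λ x → x ∈ A × IsImage φ (face i) x) → img f i ∈ A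
  found i (x , x∈ , im) = subst (_∈ A)
    (sym (img-⊆ f i λ y y∈ → Equivalence.from (im (φ y)) (y , ∈-face⁺ y∈ , refl))) x∈

-- Search for copies

any-vec? : ∀ n (xs : List ℕ) {Q : Vec ℕ n → Set} → (∀ v → Dec (Q v)) →
           Dec (∃ λ v → VAll.All (_∈ xs) v × Q v)
any-vec? zero xs Q? = map′ (λ q → [] , VAll.[] , q) (λ { ([] , _ , q) → q }) (Q? [])
any-vec? (suc n) xs {Q} Q? = map′ to from (Any.any? (λ a → any-vec? n xs (λ v → Q? (a ∷ v))) xs)
  where
  to : Any (λ a → ∃ λ v → VAll.All (_∈ xs) v × Q (a ∷ v)) xs → ∃ λ v → VAll.All (_∈ xs) v × Q v
  to p with find p
  ... | a , a∈ , v , v∈ , q = a ∷ v , a∈ VAll.∷ v∈ , q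
  from : (∃ λ v → VAll.All (_∈ xs) v × Q v) → Any (λ a → ∃ λ v → VAll.All (_∈ xs) v × Q (a ∷ v)) xs
  from (a ∷ v , a∈ VAll.∷ v∈ , q) = lose a∈ (v , v∈ , q)

Extensional : (Copy → Set) → Set
Extensional P = ∀ f h → (∀ y → at f y ≡ at h y) → P f → P h

-- The search runs over tables of values; extensionality carries the property from a copy to its
-- table.
any-copy? : ∀ (xs : List ℕ) {P : Copy → Set} → Extensional P → (∀ f → Dec (P f)) →
            Dec (∃ λ f → (∀ y → at f y ∈ xs) × P f)
any-copy? xs {P} ext P? = map′ to from (any-vec? 11 xs Q?)
  where
  Inj : Vec ℕ 11 → Set
  Inj v = ∀ x y → lookup v x ≡ lookup v y → x ≡ y
  asCopy : ∀ v → Inj v → Copy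
  asCopy v inj = copy (lookup v) (λ {x} {y} → inj x y)
  Q : Vec ℕ 11 → Set
  Q v = ∃ λ (inj : Inj v) → P (asCopy v inj)
  Q? : ∀ v → Dec (Q v)
  Q? v with all? (λ x → all? λ y → (lookup v x ℕ.≟ lookup v y) →-dec (x F.≟ y))
  ... | no n = no λ (inj , _) → n inj
  ... | yes inj = map′ (inj ,_) (λ (inj′ , p) → ext (asCopy v inj′) (asCopy v inj) (λ _ → refl) p) (P? (asCopy v inj))
  to : (∃ λ v → VAll.All (_∈ xs) v × Q v) → ∃ λ f → (∀ y → at f y ∈ xs) × P f
  to (v , v∈ , inj , p) = asCopy v inj , (λ y → VAll.lookup v∈ (V∈.∈-lookup y v)) , p
  from : (∃ λ f → (∀ y → at f y ∈ xs) × P f) → ∃ λ v → VAll.All (_∈ xs) v × Q v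
  from (f , f∈ , p) = v , values (at f) f∈ , inj , ext f (asCopy v inj) (λ y → sym (look y)) p
    where
    v = V.tabulate (at f)
    look : ∀ y → lookup v y ≡ at f y
    look = V.lookup∘tabulate (at f)
    inj : Inj v
    inj x y e = injective f (trans (sym (look x)) (trans e (look y)))
    values : ∀ {n} (h : Fin n → ℕ) → (∀ y → h y ∈ xs) → VAll.All (_∈ xs) (V.tabulate h)
    values {zero}  h h∈ = VAll.[]
    values {suc n} h h∈ = h∈ zero VAll.∷ values (h ∘ suc) (h∈ ∘ suc)

values : Edges → List ℕ
values = concatMap (V.toList ∘ vertices)

∈-values : ∀ {A e v} → e ∈ A → v ∈ᵉ e → v ∈ values A
∈-values {v = v} e∈ v∈ = ∈-concatMap⁺ (V.toList ∘ vertices) (lose e∈ (V∈.∈-toList⁺ v∈))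

∈⇒≤sum : ∀ {v xs} → v ∈ xs → v ≤ sum xs
∈⇒≤sum {xs = x ∷ xs} (here refl) = ℕ.m≤m+n x (sum xs)
∈⇒≤sum {xs = x ∷ xs} (there v∈)  = ≤-trans (∈⇒≤sum v∈) (ℕ.m≤n+m (sum xs) x)

-- Sums stand in for maxima: every number from here on is new both to `A` and to the copy.
bound : Edges → Copy → ℕ
bound A f = suc (sum (values A) + sum (L.tabulate (at f)))

edge<bound : ∀ {A} f {e v} → e ∈ A → v ∈ᵉ e → v < bound A f
edge<bound f e∈ v∈ = s≤s (≤-trans (∈⇒≤sum (∈-values e∈ v∈)) (ℕ.m≤m+n _ _))

copy<bound : ∀ A f y → at f y < bound A f
copy<bound A f y = s≤s (≤-trans (∈⇒≤sum (∈-tabulate⁺ {f = at f} y)) (ℕ.m≤n+m _ (sum (values A))))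
  where open import Data.List.Membership.Propositional.Properties using (∈-tabulate⁺)

unclaimed : ∀ {A} f {e v} → bound A f ≤ v → v ∈ᵉ e → e ∉ A
unclaimed f b≤v v∈ e∈ = ℕ.<⇒≱ (edge<bound f e∈ v∈) b≤v

core? : ∀ i → Dec (Core i)
core? i = ¬? (i F.≟ r) ×-dec ¬? (i F.≟ g)

Open : Edges → Edges → Copy → Set
Open A B h = ∃ λ k → Threat A h k × img h k ∉ A × img h k ∉ B

threat-values : ∀ {A} h k → Threat A h k → ∀ y → at h y ∈ values A
threat-values {A} h k th y with degree y k k k
... | inj₂ (i , i≢k , _ , _ , y∈) = ∈-values (th i i≢k) (∈-img⁺ h y∈)
-- Of the two spokes at z at most one is missing.
... | inj₁ refl with k F.≟ r
...   | yes refl = ∈-values (th g (λ ())) (∈-img⁺ h (z∈spoke 1F))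
...   | no k≢r   = ∈-values (th r (λ e → k≢r (sym e))) (∈-img⁺ h (z∈spoke 0F))

opaque
  open? : ∀ A B → Dec (∃ (Open A B))
  open? A B = map′ (λ (h , _ , o) → h , o)
    (λ (h , k , th , rest) → h , threat-values h k th , k , th , rest)
    (any-copy? (values A) ext λ h → any? λ k →
      (all? λ i → ¬? (i F.≟ k) →-dec (img h i ∈ˡ? A)) ×-dec ¬? (img h k ∈ˡ? A) ×-dec ¬? (img h k ∈ˡ? B))
    where
    ext : Extensional (Open A B)
    ext f h eq (k , th , ∉A , ∉B) = k , (λ i i≢k → subst (_∈ A) (same i) (th i i≢k)) ,
      subst (_∉ A) (same k) ∉A , subst (_∉ B) (same k) ∉B
      where
      same : ∀ i → img f i ≡ img h i
      same i = img-cong f h λ y _ → eq y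

opaque
  inside? : ∀ h b d b′ → Dec (Inside h b d b′)
  inside? h b d b′ = all? λ y → (y ∈ᶜ? spoke b) →-dec (¬? (y F.≟ z) →-dec
    any? λ y′ → (y′ ∈ᶜ? spoke b′) ×-dec ¬? (y′ F.≟ z) ×-dec (at h y ℕ.≟ at d y′))

inside-cong : ∀ f h {b d b′} → (∀ y → y ≢ z → at f y ≡ at h y) → Inside f b d b′ → Inside h b d b′
inside-cong f h eq ins y y∈ y≢z = let (w , w∈ , w≢z , e) = ins y y∈ y≢z in w , w∈ , w≢z , trans (sym (eq y y≢z)) e

coreIn-cong : ∀ {A} f h → (∀ y → y ≢ z → at f y ≡ at h y) → CoreIn A f → CoreIn A h
coreIn-cong {A} f h eq inA i c = subst (_∈ A) (img-cong f h λ y y∈ → eq y (core-≢z c y∈)) (inA i c)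

Harmful : Copy → Side → Edges → Copy → Set
Harmful d b A h = ∃ λ c → CoreIn A h × Inside h c d b × ¬ Inside h (mate c) d (mate b)

harmful-cong : ∀ {d b A} f h → (∀ y → y ≢ z → at f y ≡ at h y) → Harmful d b A f → Harmful d b A h
harmful-cong {d} {b} f h eq (c , inA , ins , out) = c , coreIn-cong f h eq inA ,
  inside-cong f h {c} {d} {b} eq ins ,
  λ ins′ → out (inside-cong h f {mate c} {d} {mate b} (λ y y≢z → sym (eq y y≢z)) ins′)

opaque
  -- No condition involves the value at z, so z may be moved to one fixed new number; every other
  -- vertex lies in a core edge and hence on an edge of `A`.
  harmful? : ∀ d b A → Dec (∃ (Harmful d b A))
  harmful? d b A = map′ (λ (h , _ , p) → h , p) from
    (any-copy? xs (λ f h eq → harmful-cong {d} {b} f h λ y _ → eq y) λ h → any? λ c →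
      (all? λ i → core? i →-dec (img h i ∈ˡ? A)) ×-dec inside? h c d b ×-dec ¬? (inside? h (mate c) d (mate b)))
    where
    ζ : ℕ
    ζ = bound A d
    xs : List ℕ
    xs = ζ ∷ values A
    from : ∃ (Harmful d b A) → ∃ λ h → (∀ y → at h y ∈ xs) × Harmful d b A h
    from (h , p@(_ , inA , _)) = relocate h ζ off , inside-xs ,
      harmful-cong {d} {b} h (relocate h ζ off) (λ y y≢z → sym (relocate-≢z h ζ off y y≢z)) p
      where
      witness : ∀ y → y ≢ z → ∃ λ i → Core i × y ∈ᶜ i
      witness y y≢z with degree-core y r r
      ... | inj₁ e = contradiction e y≢z
      ... | inj₂ (i , i≢r , i≢g , _ , _ , y∈) = i , (i≢r , i≢g) , y∈
      off : Off h ζ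
      off y y≢z e = let (i , c , y∈) = witness y y≢z in
        ℕ.<-irrefl e (edge<bound d (inA i c) (∈-img⁺ h y∈))
      inside-xs : ∀ y → at (relocate h ζ off) y ∈ xs
      inside-xs y with y F.≟ z
      ... | yes _  = here refl
      ... | no y≢z = let (i , c , y∈) = witness y y≢z in there (∈-values (inA i c) (∈-img⁺ h y∈))

harmless : ∀ d b A → ¬ ∃ (Harmful d b A) → Harmless d b A
harmless d b A none h c inA ins = decidable-stable (inside? h (mate c) d (mate b)) λ out → none (h , c , inA , ins , out)

-- At least one of the two spokes is safe for the defender to play; this is where
-- spokes-paired excludes that both are bad.
harmless-side : ∀ d A → (∀ h k → CoreIn A h → CoreIn A k → ∃ λ f → ∃ λ x → Within f x h × Within f x k) →
                ∃ λ b → Harmless d b A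
harmless-side d A near-cores with harmful? d 1F A
... | no none = 1F , harmless d 1F A none
... | yes (h , c , inA , ins , out) = 0F , λ k c′ inA′ ins′ →
  let (f , x , wh , wk) = near-cores h k inA inA′
  in contradiction (spokes-paired f x h k d c c′ wh wk ins ins′) out

-- The defence

disjoint-consʳ : ∀ {A B y} → Disjoint A B → y ∉ A → Disjoint A (y ∷ B)
disjoint-consʳ dis y∉ e∈ (here refl) = y∉ e∈
disjoint-consʳ dis y∉ e∈ (there e∈′) = dis e∈ e∈′

disjoint-consˡ : ∀ {A B x} → Disjoint A B → x ∉ B → Disjoint (x ∷ A) B
disjoint-consˡ dis x∉ (here refl) = x∉
disjoint-consˡ dis x∉ (there e∈)  = dis e∈

∉-cons : ∀ {A : Edges} {x y} → y ≢ x → y ∉ A → y ∉ x ∷ A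
∉-cons y≢x y∉ (here e)   = y≢x e
∉-cons y≢x y∉ (there y∈) = y∉ y∈

-- `a` selects the variant of edge 6 and `b` that of edge 7; by `same₆` and `same₇` neither choice
-- affects the other edge.
record Forked (A B : Edges) : Set where
  field
    fork  : Fin 2 → Fin 2 → Copy
    old   : ∀ a b i → toℕ i < 6 → img (fork a b) i ∈ B
    same₆ : ∀ a b b′ → img (fork a b) 6F ≡ img (fork a b′) 6F
    same₇ : ∀ a a′ b → img (fork a b) 7F ≡ img (fork a′ b) 7F
    diff₆ : ∀ b → img (fork 0F b) 6F ≢ img (fork 1F b) 6F
    diff₇ : ∀ a → img (fork a 0F) 7F ≢ img (fork a 1F) 7F
    free₆ : ∀ a b → img (fork a b) 6F ∉ A × img (fork a b) 6F ∉ B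
    free₇ : ∀ a b → img (fork a b) 7F ∉ A × img (fork a b) 7F ∉ B

CoreBut : Index → Edges → Copy → Set
CoreBut k B f = ∀ i → Core i → i ≢ k → img f i ∈ B

-- How the attacker stands against a complete core: too few edges for a threat so far; or a threat
-- whose missing core edge was taken, which ends it; or one whose missing edge was a spoke, so that
-- new spokes on the same core can still threaten.
data Attack (A B : Edges) : Set where
  idle    : length A ≤ 8 → Attack A B
  blocked : ∀ f k → Core k → (∀ {a} → a ∈ A → ∃ λ i → i ≢ k × a ≡ img f i) → img f k ∈ B → Attack A B
  starry  : ∀ f → Starry f A B → Attack A B

-- The positions with the attacker, who owns A, to move.  The defender, who owns B, has
-- · claimed the first i edges of a core,
-- · claimed all but two edges of a core, with two ways to add either,
-- · claimed all but one edge of a core, with two ways to add it,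
-- · claimed a core, and no forced sequence is running,
-- · just claimed one spoke of a core with the new vertex ζ.
data Phase (A B : Edges) : Set where
  building : ∀ (i : Fin 6) f → (∀ k → toℕ k < toℕ i → img f k ∈ B) → length A ≤ toℕ i → Phase A B
  forked   : Forked A B → length A ≤ 6 → Phase A B
  poised   : ∀ f h k → Core k → CoreBut k B f → CoreBut k B h → img f k ≢ img h k →
             img f k ∉ A × img f k ∉ B → img h k ∉ A × img h k ∉ B → length A ≤ 7 → Phase A B
  ready    : ∀ d → CoreIn B d → Attack A B → Phase A B
  forcing  : ∀ d b A₀ ζ (off : Off d ζ) → CoreIn B d →
             (∀ h k → Threat A₀ h k → img h k ∈ B) → Harmless d b A₀ →
             (∀ {a} → a ∈ A₀ → a ∈ A) → (∀ {a} → a ∈ A → a ∈ A₀ ⊎ Answer d b A₀ B a) → (∀ {e} → e ∈ A₀ → ¬ ζ ∈ᵉ e) →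
             img (relocate d ζ off) (spoke (mate b)) ∈ B →
             img (relocate d ζ off) (spoke b) ∉ A × img (relocate d ζ off) (spoke b) ∉ B → Phase A B

Quiet : Edges → Edges → Set
Quiet A B = Disjoint A B × Phase A B

Answered : Edges → Edges → Set
Answered = Reply hypergraph Quiet

Free : Edges → Set
Free A = ¬ ContainsCopy hypergraph A

reply : ∀ {A B} y → Disjoint A B → y ∉ A → y ∉ B → Phase A (y ∷ B) → Answered A B
reply y dis y∉A y∉B phase = continue y y∉A y∉B ((λ {e} → disjoint-consʳ dis y∉A {e}) , phase)

free-short : ∀ {A} → length A ≤ 9 → Free A
free-short {A} len c with contains⁻ c
... | f , inA = ℕ.<⇒≱ (s≤s len) (≤-trans (ℕ.≤-reflexive (sym (L.length-map (img f) (allFin 10))))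
  (unique-⊆-length (edgesOf-unique f (Unique.allFin⁺ 10)) sub))
  where
  sub : ∀ {e} → e ∈ edgesOf f (allFin 10) → e ∈ A
  sub e∈ with ∈-map⁻ (img f) e∈
  ... | i , _ , refl = inA i

-- Building a core

grow : ∀ f (b N : ℕ) → (∀ y → at f y < N) → Copy
grow f b N f<N = copy (λ y → pick y (toℕ y ℕ.<? b)) (λ {x} {y} → inj x y (toℕ x ℕ.<? b) (toℕ y ℕ.<? b))
  where
  pick : ∀ y → Dec (toℕ y < b) → ℕ
  pick y (yes _) = at f y
  pick y (no _)  = N + toℕ y
  inj : ∀ x y (p : Dec (toℕ x < b)) (q : Dec (toℕ y < b)) → pick x p ≡ pick y q → x ≡ y
  inj x y (yes _) (yes _) e = injective f e
  inj x y (no _)  (no _)  e = F.toℕ-injective (ℕ.+-cancelˡ-≡ N (toℕ x) (toℕ y) e)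
  inj x y (yes _) (no _)  e = contradiction e (ℕ.<⇒≢ (≤-trans (f<N x) (ℕ.m≤m+n N (toℕ y))))
  inj x y (no _)  (yes _) e = contradiction (sym e) (ℕ.<⇒≢ (≤-trans (f<N y) (ℕ.m≤m+n N (toℕ x))))

grow-old : ∀ f b N f<N y → toℕ y < b → at (grow f b N f<N) y ≡ at f y
grow-old f b N f<N y y<b with toℕ y ℕ.<? b
... | yes _  = refl
... | no y≮b = contradiction y<b y≮b

grow-new : ∀ f b N f<N y → b ≤ toℕ y → N ≤ at (grow f b N f<N) y
grow-new f b N f<N y b≤y with toℕ y ℕ.<? b
... | yes y<b = contradiction b≤y (ℕ.<⇒≱ y<b)
... | no _    = ℕ.m≤m+n N (toℕ y)

twin : Fin 3 → Copy → Copy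
twin s f = copy (at f ∘ swap s) λ {x} {y} e →
  trans (sym (swap-involutive s x)) (trans (cong (swap s) (injective f e)) (swap-involutive s y))

img-twin : ∀ s f {i} → Core i → i ≢ last s → img (twin s f) i ≡ img f i
img-twin s f {i} (i≢r , i≢g) i≢ = img-⊆ (twin s f) i λ y y∈ → ∈-img⁺ f (swap-core s i i≢r i≢g i≢ y y∈)

img-twin-last : ∀ s f → s ≢ 0F → img (twin s f) (last s) ≢ img f (last s)
img-twin-last s f s≢0 e with swap-last s s≢0
... | y , y∈ , y∉ = y∉ (∈-img f (subst (at f (swap s y) ∈ᵉ_) e (∈-img⁺ (twin s f) y∈)))

first second : Fin 2 → Fin 3
first 0F = 0F
first 1F = 1F
second 0F = 0F
second 1F = 2F

swap-nine : ∀ s → swap s 9F ≡ 9F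
swap-nine 0F = refl
swap-nine 1F = refl
swap-nine 2F = refl

small-core : ∀ i → toℕ i < 8 → Core i
small-core i lt = (λ { refl → ℕ.<-irrefl refl lt }) , (λ { refl → ℕ.<⇒≱ lt (ℕ.n≤1+n 8) })

small-≢last : ∀ s i → toℕ i < 6 → i ≢ last s
small-≢last 0F .8F lt refl = ℕ.<⇒≱ lt (ℕ.m≤m+n 6 2)
small-≢last 1F .6F lt refl = ℕ.<-irrefl refl lt
small-≢last 2F .7F lt refl = ℕ.<⇒≱ lt (ℕ.n≤1+n 6)

-- Vertex 9 lies in edges 6 and 7 and is fixed by both swaps. It is new to the board when edge 5 is
-- claimed, so nobody owns any variant of these two edges.
fork-at : ∀ {A B} f → (∀ k → toℕ k < 6 → img f k ∈ B) → (∀ {e} → at f 9F ∈ᵉ e → e ∉ A) →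
          (∀ {e} → e ∈ B → at f 9F ∈ᵉ e → e ≡ img f 5F) → Forked A B
fork-at {A} {B} f old new only = record
  { fork = fork
  ; old = λ a b i i<6 → subst (_∈ B) (sym (small a b i i<6)) (old i i<6)
  ; same₆ = λ a b b′ → trans (six a b) (sym (six a b′))
  ; same₇ = λ a a′ b → trans (seven a b) (sym (seven a′ b))
  ; diff₆ = λ b e → img-twin-last 1F f (λ ()) (sym (trans (sym (img-cong (twin 0F f) f λ _ _ → refl))
                    (trans (sym (six 0F b)) (trans e (six 1F b)))))
  ; diff₇ = λ a e → img-twin-last 2F f (λ ()) (sym (trans (sym (img-cong (twin 0F f) f λ _ _ → refl))
                    (trans (sym (seven a 0F)) (trans e (seven a 1F)))))
  ; free₆ = λ a b → free a b 6F (nine∈last 1F (λ ())) (λ ())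
  ; free₇ = λ a b → free a b 7F (nine∈last 2F (λ ())) (λ ())
  }
  where
  fork : Fin 2 → Fin 2 → Copy
  fork a b = twin (second b) (twin (first a) f)
  small : ∀ a b i → toℕ i < 6 → img (fork a b) i ≡ img f i
  small a b i i<6 = trans
    (img-twin (second b) (twin (first a) f) c (small-≢last (second b) i i<6))
    (img-twin (first a) f c (small-≢last (first a) i i<6))
    where c = small-core i (≤-trans i<6 (ℕ.m≤m+n 6 2))
  six : ∀ a b → img (fork a b) 6F ≡ img (twin (first a) f) 6F
  six a 0F = img-twin 0F (twin (first a) f) ((λ ()) , (λ ())) (λ ())
  six a 1F = img-twin 2F (twin (first a) f) ((λ ()) , (λ ())) (λ ())
  seven : ∀ a b → img (fork a b) 7F ≡ img (twin (second b) f) 7F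
  seven a b = trans
    (img-cong (fork a b) (twin (first a) (twin (second b) f)) λ y _ → cong (at f) (swap-commute (first a) (second b) y))
    (other a)
    where
    other : ∀ a → img (twin (first a) (twin (second b) f)) 7F ≡ img (twin (second b) f) 7F
    other 0F = img-twin 0F (twin (second b) f) ((λ ()) , (λ ())) (λ ())
    other 1F = img-twin 1F (twin (second b) f) ((λ ()) , (λ ())) (λ ())
  free : ∀ a b i → 9F ∈ᶜ i → i ≢ 5F → img (fork a b) i ∉ A × img (fork a b) i ∉ B
  free a b i 9∈ i≢5 = new nine , λ i∈ → i≢5 (img-injective (fork a b)
    (trans (only i∈ nine) (sym (small a b 5F (ℕ.≤-refl)))))
    where
    nine : at f 9F ∈ᵉ img (fork a b) i
    nine = subst (_∈ᵉ img (fork a b) i)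
      (cong (at f) (trans (cong (swap (first a)) (swap-nine (second b))) (swap-nine (first a))))
      (∈-img⁺ (fork a b) 9∈)

build : ∀ {A B} (i : Fin 6) f → (∀ k → toℕ k < toℕ i → img f k ∈ B) → length A ≤ suc (toℕ i) →
        Disjoint A B → Answered A B
build {A} {B} i f old len dis = reply y dis y∉A y∉B (advance (toℕ i ℕ.<? 5))
  where
  N : ℕ
  N = bound (A L.++ B) f
  f<N : ∀ y → at f y < N
  f<N = copy<bound (A L.++ B) f
  F : Copy
  -- The edges claimed so far use only vertices below 4 + i; the others are uncommitted and move
  -- beyond everything on the board.
  F = grow f (4 + toℕ i) N f<N
  k₀ : Index
  k₀ = i F.↑ˡ 4
  k₀≡ : toℕ k₀ ≡ toℕ i
  k₀≡ = F.toℕ-↑ˡ i 4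
  y : Edge 5
  y = img F k₀
  fresh : ∀ {v e} → N ≤ v → v ∈ᵉ e → e ∉ A × e ∉ B
  fresh N≤ v∈ = unclaimed f N≤ v∈ ∘ ∈-++⁺ˡ , unclaimed f N≤ v∈ ∘ ∈-++⁺ʳ A
    where open import Data.List.Membership.Propositional.Properties using (∈-++⁺ˡ; ∈-++⁺ʳ)
  y-fresh : y ∉ A × y ∉ B
  y-fresh with new-corner i k₀ k₀≡
  ... | w , w∈ , new = fresh (grow-new f _ N f<N w new) (∈-img⁺ F w∈)
  y∉A = proj₁ y-fresh
  y∉B = proj₂ y-fresh
  kept : ∀ k → toℕ k < toℕ i → img F k ≡ img f k
  kept k k<i = img-cong F f λ w w∈ → grow-old f _ N f<N w (old-corner i k w k<i w∈)
  extended : ∀ k → toℕ k < suc (toℕ i) → img F k ∈ y ∷ B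
  extended k k<1+i with ℕ.m≤n⇒m<n∨m≡n (ℕ.≤-pred k<1+i)
  ... | inj₁ k<i = there (subst (_∈ B) (sym (kept k k<i)) (old k k<i))
  ... | inj₂ k≡i = here (cong (img F) (F.toℕ-injective (trans k≡i (sym k₀≡))))
  advance : Dec (toℕ i < 5) → Phase A (y ∷ B)
  advance (yes i<5) = building (F.fromℕ< (s≤s i<5)) F
    (λ k k< → extended k (subst (toℕ k <_) (F.toℕ-fromℕ< (s≤s i<5)) k<))
    (≤-trans len (ℕ.≤-reflexive (sym (F.toℕ-fromℕ< (s≤s i<5)))))
  advance (no i≮5) = forked
    (fork-at F (λ k k<6 → extended k (subst (λ n → toℕ k < suc n) (sym i≡5) k<6))
      (λ v∈ → proj₁ (fresh nine-new v∈)) only)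
    (subst (λ n → length A ≤ suc n) i≡5 len)
    where
    i≡5 : toℕ i ≡ 5
    i≡5 = ℕ.≤-antisym (ℕ.≤-pred (F.toℕ<n i)) (ℕ.≮⇒≥ i≮5)
    nine-new : N ≤ at F 9F
    nine-new = grow-new f _ N f<N 9F (ℕ.≤-reflexive (cong (4 +_) i≡5))
    only : ∀ {e} → e ∈ y ∷ B → at F 9F ∈ᵉ e → e ≡ img F 5F
    only (here refl) _  = cong (img F) (F.toℕ-injective (trans k₀≡ i≡5))
    only (there e∈)  v∈ = contradiction e∈ (proj₂ (fresh nine-new v∈))

core-mono : ∀ {B y} f → CoreIn B f → CoreIn (y ∷ B) f
core-mono f inB i c = there (inB i c)

base : Copy
base = copy toℕ F.toℕ-injective

fresh-off : ∀ A f → Off f (bound A f)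
fresh-off A f y _ e = ℕ.<-irrefl e (copy<bound A f y)

fresh-spoke : ∀ A f b → img (relocate f (bound A f) (fresh-off A f)) (spoke b) ∉ A
fresh-spoke A f b = unclaimed f ℕ.≤-refl (∈-img⁺ (relocate f (bound A f) (fresh-off A f)) (z∈spoke b))

spare : ∀ (h : History 5) → Σ (Edge 5) (_∉ h)
spare h = img (relocate base (bound h base) (fresh-off h base)) r , fresh-spoke h base 0F

poised-reply : ∀ {A B x} f h k → Disjoint (x ∷ A) B → Core k → CoreBut k B f → CoreBut k B h →
  img f k ≢ img h k → img f k ∉ A × img f k ∉ B → img h k ∉ A × img h k ∉ B → length A ≤ 7 → Answered (x ∷ A) B
poised-reply {A} {B} {x} f h k dis ck inf inh ne freef freeh len = choose (img f k ≟ᵉ x)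
  where
  complete : ∀ e → CoreBut k B e → img e k ≢ x → img e k ∉ A × img e k ∉ B → Answered (x ∷ A) B
  complete e inB e≢x (∉A , ∉B) = reply (img e k) dis (∉-cons e≢x ∉A) ∉B (ready e core (idle (s≤s len)))
    where
    core : CoreIn (img e k ∷ B) e
    core i c with i F.≟ k
    ... | yes refl = here refl
    ... | no i≢k   = there (inB i c i≢k)
  choose : Dec (img f k ≡ x) → Answered (x ∷ A) B
  choose (no f≢x) = complete f inf f≢x freef
  choose (yes e)  = complete h inh (λ e′ → ne (trans e (sym e′))) freeh

small-or-last : ∀ i → Core i → toℕ i < 6 ⊎ i ≡ 6F ⊎ i ≡ 7F
small-or-last 0F _ = inj₁ (s≤s z≤n)
small-or-last 1F _ = inj₁ (s≤s (s≤s z≤n))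
small-or-last 2F _ = inj₁ (s≤s (s≤s (s≤s z≤n)))
small-or-last 3F _ = inj₁ (s≤s (s≤s (s≤s (s≤s z≤n))))
small-or-last 4F _ = inj₁ (s≤s (s≤s (s≤s (s≤s (s≤s z≤n)))))
small-or-last 5F _ = inj₁ (s≤s (s≤s (s≤s (s≤s (s≤s (s≤s z≤n))))))
small-or-last 6F _ = inj₂ (inj₁ refl)
small-or-last 7F _ = inj₂ (inj₂ refl)
small-or-last 8F (n , _) = contradiction refl n
small-or-last 9F (_ , n) = contradiction refl n

module _ {A B : Edges} {x : Edge 5} (dis : Disjoint (x ∷ A) B) (F : Forked A B) (len : length A ≤ 6) where
  open Forked F

  play₆ : ∀ a → img (fork a 0F) 6F ≢ x → (∀ b → img (fork 0F b) 7F ≢ x) → Answered (x ∷ A) B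
  play₆ a ne free = reply y dis (∉-cons ne (proj₁ (free₆ a 0F))) (proj₂ (free₆ a 0F))
    (poised (fork a 0F) (fork a 1F) 7F ((λ ()) , (λ ())) (but 0F) (but 1F) (diff₇ a) (open₇ 0F) (open₇ 1F) (s≤s len))
    where
    y : Edge 5
    y = img (fork a 0F) 6F
    but : ∀ b → CoreBut 7F (y ∷ B) (fork a b)
    but b i c i≢7 with small-or-last i c
    ... | inj₁ lt          = there (old a b i lt)
    ... | inj₂ (inj₁ refl) = here (same₆ a b 0F)
    ... | inj₂ (inj₂ refl) = contradiction refl i≢7
    open₇ : ∀ b → img (fork a b) 7F ∉ x ∷ A × img (fork a b) 7F ∉ y ∷ B
    open₇ b = ∉-cons (λ e → free b (trans (same₇ 0F a b) e)) (proj₁ (free₇ a b)) ,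
      ∉-cons (λ e → contradiction (img-injective (fork a b) (trans e (same₆ a 0F b))) (λ ())) (proj₂ (free₇ a b))

  play₇ : ∀ b → img (fork 0F b) 7F ≢ x → (∀ a → img (fork a 0F) 6F ≢ x) → Answered (x ∷ A) B
  play₇ b ne free = reply y dis (∉-cons ne (proj₁ (free₇ 0F b))) (proj₂ (free₇ 0F b))
    (poised (fork 0F b) (fork 1F b) 6F ((λ ()) , (λ ())) (but 0F) (but 1F) (diff₆ b) (open₆ 0F) (open₆ 1F) (s≤s len))
    where
    y : Edge 5
    y = img (fork 0F b) 7F
    but : ∀ a → CoreBut 6F (y ∷ B) (fork a b)
    but a i c i≢6 with small-or-last i c
    ... | inj₁ lt          = there (old a b i lt)
    ... | inj₂ (inj₁ refl) = contradiction refl i≢6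
    ... | inj₂ (inj₂ refl) = here (same₇ a 0F b)
    open₆ : ∀ a → img (fork a b) 6F ∉ x ∷ A × img (fork a b) 6F ∉ y ∷ B
    open₆ a = ∉-cons (λ e → free a (trans (same₆ a 0F b) e)) (proj₁ (free₆ a b)) ,
      ∉-cons (λ e → contradiction (img-injective (fork a b) (trans e (same₇ 0F a b))) (λ ())) (proj₂ (free₆ a b))

  -- If `x` is a variant of edge 7, the other variant is claimed and both variants of edge 6 stay
  -- free. Otherwise an available variant of edge 6 is claimed and both variants of edge 7 stay
  -- free.
  forked-reply : Answered (x ∷ A) B
  forked-reply = choose (img (fork 0F 0F) 7F ≟ᵉ x) (img (fork 0F 1F) 7F ≟ᵉ x) (img (fork 0F 0F) 6F ≟ᵉ x)
    where
    not₆ : ∀ b → img (fork 0F b) 7F ≡ x → ∀ a → img (fork a 0F) 6F ≢ x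
    not₆ b e a e′ = contradiction (img-injective (fork a b)
      (trans (same₆ a b 0F) (trans e′ (trans (sym e) (same₇ 0F a b))))) (λ ())
    choose : Dec (img (fork 0F 0F) 7F ≡ x) → Dec (img (fork 0F 1F) 7F ≡ x) → Dec (img (fork 0F 0F) 6F ≡ x) → Answered (x ∷ A) B
    choose (yes e) _ _ = play₇ 1F (λ e′ → diff₇ 0F (trans e (sym e′))) (not₆ 0F e)
    choose (no _) (yes e) _ = play₇ 0F (λ e′ → diff₇ 0F (trans e′ (sym e))) (not₆ 1F e)
    choose (no n₀) (no n₁) (no n) = play₆ 0F n λ { 0F → n₀ ; 1F → n₁ }
    choose (no n₀) (no n₁) (yes e) = play₆ 1F (λ e′ → diff₆ 0F (trans e (sym e′))) λ { 0F → n₀ ; 1F → n₁ }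

-- The endless sequence and the blocking of threats

Quiescent : Edges → Edges → Set
Quiescent A B = ∀ h k → Threat A h k → img h k ∈ B

-- The harmless side `b` is the one left to the attacker, so the defender claims the spoke of
-- `mate b`. As `A₀` is never enlarged, its harmlessness carries over from round to round.
force : ∀ {A B} d b A₀ → Disjoint A B → CoreIn B d → Quiescent A₀ B → Harmless d b A₀ →
        (∀ {a} → a ∈ A₀ → a ∈ A) → (∀ {a} → a ∈ A → a ∈ A₀ ⊎ Answer d b A₀ B a) → Answered A B
force {A} {B} d b A₀ dis core quiet harmless A₀⊆A answers =
  reply y dis (fresh (mate b) ∘ ∈-++⁺ˡ) (fresh (mate b) ∘ ∈-++⁺ʳ A)
    (forcing d b A₀ ζ off (core-mono d core) (λ h k th → there (quiet h k th)) harmless A₀⊆A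
      (λ a∈ → [ inj₁ , (λ (ζ , off , e , p , q) → inj₂ (ζ , off , e , there p , λ {e′} → q {e′})) ]′ (answers a∈))
      (λ e∈ ζ∈ → unclaimed d ℕ.≤-refl ζ∈ (∈-++⁺ˡ (A₀⊆A e∈)))
      (here refl)
      (fresh b ∘ ∈-++⁺ˡ , ∉-cons (λ e → spoke-mate b (img-injective D e)) (fresh b ∘ ∈-++⁺ʳ A)))
  where
  ζ : ℕ
  ζ = bound (A L.++ B) d
  off : Off d ζ
  off = fresh-off (A L.++ B) d
  D : Copy
  D = relocate d ζ off
  y : Edge 5
  y = img D (spoke (mate b))
  fresh : ∀ c → img D (spoke c) ∉ A L.++ B
  fresh c = fresh-spoke (A L.++ B) d c

-- Before the move no threat was open, so `x` completes nothing; unless `x` is the forced answer,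
-- the defender completes a copy at once.
forcing-step : ∀ {A B} x d b A₀ ζ (off : Off d ζ) → Disjoint A B → x ∉ A → x ∉ B → CoreIn B d →
  Quiescent A₀ B → Harmless d b A₀ → (∀ {a} → a ∈ A₀ → a ∈ A) →
  (∀ {a} → a ∈ A → a ∈ A₀ ⊎ Answer d b A₀ B a) → (∀ {e} → e ∈ A₀ → ¬ ζ ∈ᵉ e) →
  img (relocate d ζ off) (spoke (mate b)) ∈ B →
  img (relocate d ζ off) (spoke b) ∉ A × img (relocate d ζ off) (spoke b) ∉ B →
  Free (x ∷ A) × Answered (x ∷ A) B
forcing-step {A} {B} x d b A₀ ζ off dis x∉A x∉B core quiet harmless A₀⊆A answers new pending (∉A , ∉B) =
  free , choose (x ≟ᵉ img D (spoke b))
  where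
  D : Copy
  D = relocate d ζ off
  quiet′ : Quiescent A B
  quiet′ = forced-threats d b quiet harmless answers
  free : Free (x ∷ A)
  free c with contains⁻ c
  ... | h , inA with any? (λ i → img h i ≟ᵉ x)
  ...   | yes (i , e) = x∉B (subst (_∈ B) e (quiet′ h i λ j j≢i → tail-of (inA j) λ e′ → j≢i (img-injective h (trans e′ (sym e)))))
  ...   | no none = dis (tail-of (inA 0F) λ e → none (0F , e)) (quiet′ h 0F λ j _ → tail-of (inA j) λ e → none (j , e))
  choose : Dec (x ≡ img D (spoke b)) → Answered (x ∷ A) B
  choose (no x≢) = win (img D (spoke b)) (∉-cons (x≢ ∘ sym) ∉A) ∉B (contains⁺ D complete)
    where
    complete : ∀ i → img D i ∈ img D (spoke b) ∷ B
    complete i with core-or-spoke i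
    ... | inj₁ c = there (subst (_∈ B) (sym (img-relocate d ζ off c)) (core i c))
    ... | inj₂ (c , refl) with spoke-cases b c
    ...   | inj₁ refl = here refl
    ...   | inj₂ refl = there pending
  choose (yes e) = force d b A₀ (disjoint-consˡ dis x∉B) core quiet harmless (there ∘ A₀⊆A) answers′
    where
    answers′ : ∀ {a} → a ∈ x ∷ A → a ∈ A₀ ⊎ Answer d b A₀ B a
    answers′ (here refl) = inj₂ (ζ , off , e , pending , λ {e′} → new {e′})
    answers′ (there a∈)  = answers a∈

star-mono : ∀ {f A B y} → Starry f A B → Starry f A (y ∷ B)
star-mono st a∈ = [ inj₁ , (λ (ζ , off , b , e , p) → inj₂ (ζ , off , b , e , there p)) ]′ (st a∈)

relocate-as : ∀ f h (off : Off f (at h z)) → (∀ y → y ≢ z → at h y ≡ at f y) → ∀ i →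
              img h i ≡ img (relocate f (at h z) off) i
relocate-as f h off agree i = img-cong h (relocate f (at h z) off) λ y _ → same y
  where
  same : ∀ y → at h y ≡ at (relocate f (at h z) off) y
  same y with y F.≟ z
  ... | yes refl = refl
  ... | no y≢z   = agree y y≢z

new-star : ∀ {B a} f h b → (∀ y → y ≢ z → at h y ≡ at f y) → a ≡ img h (spoke b) →
           img h (spoke (mate b)) ∈ B → Star f B a
new-star {B} f h b agree e inB = at h z , off , b , trans e (relocate-as f h off agree (spoke b)) ,
  subst (_∈ B) (relocate-as f h off agree (spoke (mate b))) inB
  where
  off : Off f (at h z)
  off y y≢z e = y≢z (injective h (trans (agree y y≢z) e))

not-spoke : ∀ b → 0F ≢ spoke b
not-spoke 0F ()
not-spoke 1F ()

ready-step : ∀ {A B} x d → Disjoint (x ∷ A) B → CoreIn B d → Attack A B → Free (x ∷ A) × Answered (x ∷ A) B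
ready-step {A} {B} x d dis core attack = free attack , choose (open? (x ∷ A) B)
  where
  free : Attack A B → Free (x ∷ A)
  free (idle len) = free-short (s≤s len)
  free (blocked f k ck A⊆ kB) c with contains⁻ c
  ... | h , inA = dis (inA 0F) (blocked-threats f k ck dis A⊆ kB h 0F λ i _ → inA i)
  free (starry f st) c with contains⁻ c
  ... | h , inA with starry-threats f st dis h 0F (λ i _ → inA i)
  ...   | inj₁ inB             = dis (inA 0F) inB
  ...   | inj₂ (b , e , _ , _) = not-spoke (mate b) e

  near-cores : Attack A B → ∀ h k → CoreIn (x ∷ A) h → CoreIn (x ∷ A) k → ∃ λ f → ∃ λ w → Within f w h × Within f w k
  near-cores (idle len) h k inh ink with core-cover h (s≤s len) inh
  ... | w , within = h , w , within h inh , within k ink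
  near-cores (blocked f j _ A⊆ _) h k inh ink = f , x , within h inh , within k ink
    where
    within : ∀ h → CoreIn (x ∷ A) h → Within f x h
    within h inA i c with inA i c
    ... | here e   = inj₂ e
    ... | there i∈ = let (t , _ , e) = A⊆ i∈ in inj₁ (t , e)
  near-cores (starry f st) h k inh ink = f , x , core-within f st dis h inh , core-within f st dis k ink

  -- Only the first threat, which exhausts the attacker's edges, decides between `blocked` and
  -- `starry`. After `blocked` no threat can be open again, and after `starry` an open one merely
  -- adds a star.
  answer : Attack A B → ∀ h k → Threat (x ∷ A) h k → img h k ∉ B → Attack (x ∷ A) (img h k ∷ B)
  answer (idle len) h k th _ with core-or-spoke k
  ... | inj₁ ck = blocked h k ck (threat-exact h k (s≤s len) th) (here refl)
  ... | inj₂ (b , refl) = starry h st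
    where
    st : Starry h (x ∷ A) (img h (spoke b) ∷ B)
    st a∈ with threat-exact h (spoke b) (s≤s len) th a∈
    ... | i , i≢k , e with core-or-spoke i
    ...   | inj₁ c = inj₁ (i , c , e)
    ...   | inj₂ (c , refl) with spoke-cases b c
    ...     | inj₁ refl = contradiction refl i≢k
    ...     | inj₂ refl = inj₂ (new-star h h (mate b) (λ _ _ → refl) e (here (cong (img h ∘ spoke) (mate-mate b))))
  answer (blocked f j cj A⊆ jB) h k th ∉B = contradiction (blocked-threats f j cj dis A⊆ jB h k th) ∉B
  answer (starry f st) h k th ∉B with starry-threats f st dis h k th
  ... | inj₁ inB = contradiction inB ∉B
  ... | inj₂ (b , refl , e , agree) = starry f st′
    where
    st′ : Starry f (x ∷ A) (img h (spoke (mate b)) ∷ B)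
    st′ (here refl) = inj₂ (new-star f h b agree e (here refl))
    st′ (there a∈)  = star-mono {f} st a∈

  choose : Dec (∃ (Open (x ∷ A) B)) → Answered (x ∷ A) B
  -- One block suffices: in the resulting state no move of the attacker completes a copy, so no
  -- second open threat was left.
  choose (yes (h , k , th , ∉A , ∉B)) =
    reply (img h k) dis ∉A ∉B (ready d (core-mono d core) (answer attack h k th ∉B))
  choose (no none) with harmless-side d (x ∷ A) (near-cores attack)
  ... | b , harm = force d b (x ∷ A) dis core quiet harm id inj₁
    where
    quiet : Quiescent (x ∷ A) B
    quiet h k th with img h k ∈ˡ? (x ∷ A) | img h k ∈ˡ? B
    ... | _      | yes inB = inB
    ... | no ∉A  | no ∉B  = contradiction (h , k , th , ∉A , ∉B) none
    ... | yes inA | no _   = ⊥-elim (free attack (contains⁺ h all-in))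
      where
      all-in : ∀ i → img h i ∈ x ∷ A
      all-in i with i F.≟ k
      ... | yes refl = inA
      ... | no i≢k   = th i i≢k

step : ∀ {A B} → Quiet A B → ∀ x → x ∉ A → x ∉ B → Free (x ∷ A) × Answered (x ∷ A) B
step (dis , building i f old len) x _ x∉B =
  free-short (s≤s (≤-trans len (≤-trans (F.toℕ≤n i) (ℕ.m≤m+n 6 2)))) ,
  build i f old (s≤s len) (disjoint-consˡ dis x∉B)
step (dis , forked F len) x _ x∉B =
  free-short (s≤s (≤-trans len (ℕ.m≤m+n 6 2))) , forked-reply (disjoint-consˡ dis x∉B) F len
step (dis , poised f h k ck inf inh ne freef freeh len) x _ x∉B =
  free-short (s≤s (≤-trans len (ℕ.m≤m+n 7 1))) ,
  poised-reply f h k (disjoint-consˡ dis x∉B) ck inf inh ne freef freeh len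
step (dis , ready d core attack) x _ x∉B = ready-step x d (disjoint-consˡ dis x∉B) core attack
step (dis , forcing d b A₀ ζ off core quiet harm A₀⊆A answers new pending free) x x∉A x∉B =
  forcing-step x d b A₀ ζ off dis x∉A x∉B core quiet harm A₀⊆A answers new pending free

start : Phase [] []
start = building 0F base (λ _ ()) z≤n

theorem1p1 : ∃ λ (H : Hypergraph 5) → IsDraw H
theorem1p1 = hypergraph , draw
  where
  good : ∀ p → Draw.Good hypergraph p spare Quiet []
  good FP = Draw.attacking refl (free-short z≤n) ((λ ()) , start)
  -- `build` already allows for a move of the attacker, so a defender who moves first can apply it
  -- at once.
  good SP = Draw.defending refl (free-short z≤n) (build 0F base (λ _ ()) z≤n λ ())
  draw : IsDraw hypergraph
  draw p (σ , winning) = Draw.drawn hypergraph p spare Quiet step σ (good p) (winning _)
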